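{- Let $n>1$ be an integer and let $t$ be the number of primes less than $\sqrt{n/2}$. Then every isolation of $I_n$ represents the lattice $I_{n-1}\perp D_n\perp A_{n-1}\perp\dots\perp A_{n-1}$, with $t-1$ copies of $A_{n-1}$. In particular, $2n-1+(n-1)(t-1)\le \mathrm{Iso}(I_n)$, and hence $\mathrm{Iso}(I_n)\in\Omega(n^{3/2-\epsilon})$ for every $\epsilon>0$.
   Context: All $\mathbb{Z}$-lattices are positive definite with integral Gram matrix. $M$ is represented by $L$ if there is a linear map $\sigma:M\to L$ with $Q(\sigma(x))=Q(x)$. $I_n=\langle 1,\dots,1\rangle$ is the cubic lattice (sum of $n$ squares); $\perp$ is orthogonal sum. $A_{n-1}=\{(a_1,\dots,a_n)\in\mathbb{Z}^n:\sum a_i=0\}$ and $D_n=\{(a_1,\dots,a_n)\in\mathbb{Z}^n:\sum a_i\equiv 0\pmod 2\}$ (with the standard inner product). A lattice $L$ is an isolation of $\ell$ if $L$ represents every sublattice of $\ell$ except $\ell$ itself, and does not represent $\ell$; $\mathrm{Iso}(\ell)$ is the minimum rank of an isolation of $\ell$. For arithmetic functions, $f(n)\in\Omega(g(n))$ means there is $C>0$ with $C g(n)\le f(n)$ for all sufficiently large $n$.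
   Formalization: The representation claim is stated for t ≥ 1 (that is, n ≥ 9), since for 2 ≤ n ≤ 8 one has t = 0 and "t−1 copies" of A_{n-1} is undefined; the rank bound is stated for all n > 1. -}

module Defs where

open import Data.Nat as ℕ using (ℕ; zero; suc; _<?_)
open import Data.Nat.Primality using (prime?)
open import Data.Integer as ℤ using (ℤ; +_; _+_; _*_; _-_; _<_)
open import Data.Fin as Fin using (Fin; zero; suc; inject₁; splitAt)
open import Data.Sum using (_⊎_; inj₁; inj₂)
open import Data.Product using (Σ; ∃; _×_; _,_)
open import Data.List using (length; filter; upTo)
open import Data.Bool using (if_then_else_)
open import Relation.Nullary using (¬_; does)
open import Relation.Nullary.Decidable using (_×-dec_)
open import Relation.Binary.PropositionalEquality using (_≡_)

Vecℤ : ℕ → Set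
Vecℤ n = Fin n → ℤ

sumFin : ∀ {n} → (Fin n → ℤ) → ℤ
sumFin {zero}  f = + 0
sumFin {suc n} f = f zero + sumFin (λ i → f (suc i))

record QForm : Set where
  constructor qform
  field
    rank : ℕ
    gram : Fin rank → Fin rank → ℤ
open QForm public

B : (L : QForm) → Vecℤ (rank L) → Vecℤ (rank L) → ℤ
B L x y = sumFin (λ i → sumFin (λ j → x i * gram L i j * y j))

Q : (L : QForm) → Vecℤ (rank L) → ℤ
Q L x = B L x x

IsLattice : QForm → Set
IsLattice L = (∀ i j → gram L i j ≡ gram L j i)
            × (∀ (x : Vecℤ (rank L)) → ¬ (∀ i → x i ≡ + 0) → + 0 < Q L x)

apply : ∀ {m k} → (Fin m → Fin k → ℤ) → Vecℤ k → Vecℤ m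
apply T x i = sumFin (λ j → T i j * x j)

Represents : QForm → QForm → Set
Represents L M = Σ (Fin (rank L) → Fin (rank M) → ℤ)
                   (λ T → ∀ (x : Vecℤ (rank M)) → Q L (apply T x) ≡ Q M x)

_⊥_ : QForm → QForm → QForm
L ⊥ M = qform (rank L ℕ.+ rank M) g
  where
  g : Fin (rank L ℕ.+ rank M) → Fin (rank L ℕ.+ rank M) → ℤ
  g i j with splitAt (rank L) i | splitAt (rank L) j
  ... | inj₁ a | inj₁ b = gram L a b
  ... | inj₂ a | inj₂ b = gram M a b
  ... | inj₁ _ | inj₂ _ = + 0
  ... | inj₂ _ | inj₁ _ = + 0
infixr 5 _⊥_

zeroL : QForm
zeroL = qform 0 (λ ())

copies : ℕ → QForm → QForm
copies zero    M = zeroL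
copies (suc k) M = M ⊥ copies k M

e : ∀ {n} → Fin n → Vecℤ n
e i j = if does (i Fin.≟ j) then + 1 else + 0

dot : ∀ {n} → Vecℤ n → Vecℤ n → ℤ
dot x y = sumFin (λ i → x i * y i)

subLattice : (ℓ : QForm) → ∀ {k} → (Fin k → Vecℤ (rank ℓ)) → QForm
subLattice ℓ {k} v = qform k (λ i j → B ℓ (v i) (v j))

fromBasis : ∀ {n k} → (Fin k → Vecℤ n) → QForm
fromBasis {n} {k} v = qform k (λ i j → dot (v i) (v j))

lincomb : ∀ {n k} → Vecℤ k → (Fin k → Vecℤ n) → Vecℤ n
lincomb c v j = sumFin (λ i → c i * v i j)

Independent : ∀ {n k} → (Fin k → Vecℤ n) → Set
Independent {n} {k} v = ∀ (c : Vecℤ k) → (∀ j → lincomb c v j ≡ + 0) → ∀ i → c i ≡ + 0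

Spans : ∀ {n k} → (Fin k → Vecℤ n) → Set
Spans {n} {k} v = ∀ (w : Vecℤ n) → ∃ λ (c : Vecℤ k) → ∀ j → lincomb c v j ≡ w j

-- L is an isolation of ℓ: L is a lattice, represents every sublattice of ℓ
-- other than ℓ itself, and does not represent ℓ.
-- A sublattice of ℓ is given by a Z-basis v (coordinates w.r.t. ℓ's basis);
-- it equals ℓ iff v spans ℤ^{rank ℓ}.
IsIsolation : QForm → QForm → Set
IsIsolation ℓ L =
  IsLattice L
  × (∀ k (v : Fin k → Vecℤ (rank ℓ)) → Independent v → ¬ Spans v
       → Represents L (subLattice ℓ v))
  × ¬ Represents L ℓ

I : ℕ → QForm
I n = qform n (λ i j → e i j)

-- A_{n-1} = {a ∈ ℤ^n : Σ a_i = 0}, via its Z-basis e_{i+1} - e_i (i < n-1)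
Aminus1 : ℕ → QForm
Aminus1 zero    = zeroL
Aminus1 (suc m) = fromBasis {suc m} {m} (λ i j → e (suc i) j - e (inject₁ i) j)

-- D_n = {a ∈ ℤ^n : Σ a_i even}, via its Z-basis 2e_0, e_{i+1} - e_i (i < n-1)
Dbasis : ∀ m → Fin (suc m) → Vecℤ (suc m)
Dbasis m zero    j = + 2 * e zero j
Dbasis m (suc i) j = e (suc i) j - e (inject₁ i) j

D : ℕ → QForm
D zero    = zeroL
D (suc m) = fromBasis (Dbasis m)

-- t(n) = number of primes p with p < √(n/2), i.e. 2p² < n
primesBelowSqrtHalf : ℕ → ℕ
primesBelowSqrtHalf n =
  length (filter (λ p → prime? p ×-dec (2 ℕ.* p ℕ.* p <? n)) (upTo n))

{-# OPTIONS --safe #-}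
module Submission where

-- For p ≥ 2 the isolation L represents { x ∈ ℤⁿ : p ∣ Σ xᵢ }, that is, L ⊗ ℚ contains an
-- orthonormal frame a₁, …, aₙ with p aᵢ ∈ L and aᵢ - aⱼ ∈ L.  Let b be such a frame for a second
-- prime q, where 2p², 2q² < n.  A difference ρ = bⱼ - bⱼ′ has norm 2, and the numbers p (ρ · aᵢ) are
-- congruent mod p with Σ (p (ρ · aᵢ))² ≤ 2p² < n (Bessel); one of them vanishes, so all ρ · aᵢ are
-- integers.  Hence each row of the integers pq (aᵢ · bⱼ) is constant mod pq; its sum of squares is at
-- most (pq)² and n > 2pq, so it is constant unless some aᵢ = ± bⱼ.  In the latter case aᵢ ∈ L by
-- Bézout and L represents Iₙ, a contradiction.  Therefore the differences of b are orthogonal to a;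
-- the same argument with a unit vector of L in place of aᵢ (q = 1) deals with the summand Iₙ₋₁.
--
-- The growth statement needs t ≥ n^(1/2-ε).  By Chebyshev's argument the integral of (x (1 - x))ᵐ
-- over [0,1] is at most 4⁻ᵐ and has denominator dividing lcm(1, …, 2m+1) ≤ (2m+1)^π(2m+1).

-- The threshold √(n/2) enters twice: `2p² < n` forces some inner product of a norm 2 vector with a
-- frame to vanish, and for two primes it yields the `2pq < n` that makes congruent rows rigid. The
-- constant value of a row between two frames need not be zero, so only the differences of one frame
-- become orthogonal to the other frame. This is why a prime contributes just its roots, a copy of
-- `A_{n-1}`. The prime 2 alone contributes its whole congruence lattice, which is `D_n`: its one
-- further generator is a frame vector, hence orthogonal to the roots of the other primes. Unit
-- vectors of `L` do better, because `p² < n` also forces a zero in their rows.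
--
-- No rational vector occurs. A frame is stored as `u i = p aᵢ` together with vectors `r i` of `L`
-- that have the same differences as the `aᵢ`; the `r i` are fixed only up to a common translation,
-- and the identities carry factors `p²` to be cancelled. Real exponents are avoided likewise: with
-- `ε = 1 / k` the growth statement compares `2k`-th powers, and the logarithm lost in Chebyshev's
-- bound is absorbed by a power of `n`.

open import Defs

module QuadraticForms where

  open import Data.Nat as ℕ using (ℕ; zero; suc)
  import Data.Nat.Properties as ℕₚ
  import Data.Nat.Divisibility as ℕ∣
  import Data.Nat.Tactic.RingSolver as ℕRing
  open import Data.Nat.Coprimality as Coprimality using (Coprime; coprime-Bézout)
  open import Data.Nat.GCD using (module Bézout)
  open import Data.Nat.Primality using (Prime; prime⇒nonZero; prime⇒irreducible; ¬prime[1])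
  open import Data.Integer as ℤ using (ℤ; +_; _+_; _*_; _-_; -_; ∣_∣; 0ℤ; 1ℤ)
  import Data.Integer.Properties as ℤₚ
  open import Data.Integer.Divisibility.Signed using (_∣_; divides; ∣⇒∣ᵤ; *-monoʳ-∣)
  open import Data.Integer.Tactic.RingSolver using (solve-∀)
  open import Data.Fin using (Fin; zero; suc; punchIn; inject₁; _↑ˡ_; _↑ʳ_; splitAt; join)
  import Data.Fin.Properties as Finₚ
  import Data.Vec.Functional as Vec
  import Data.Vec.Functional.Properties as Vecₚ
  open import Data.List using (List; []; _∷_; length)
  open import Data.List.Relation.Unary.All as All using (All; []; _∷_)
  open import Data.List.Relation.Unary.AllPairs using (AllPairs; []; _∷_)
  open import Data.List.Relation.Unary.Any using (here; there)
  open import Data.List.Membership.Propositional using (_∈_)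
  open import Data.Product using (Σ; ∃; _×_; _,_; proj₁; proj₂)
  open import Data.Sum using (inj₁; inj₂; [_,_])
  open import Function using (_∘_)
  open import Relation.Nullary using (¬_; yes; no; contradiction)
  open import Relation.Nullary.Decidable using (¬?; decidable-stable)
  open import Relation.Binary.PropositionalEquality hiding ([_])
  import Algebra.Properties.CommutativeMonoid.Sum ℤₚ.+-0-commutativeMonoid as Sum
  import Algebra.Properties.Semiring.Sum ℤₚ.+-*-semiring as Sum*

  -- Finite sums of integers and the coordinate vectors.

  sumFin≡sum : ∀ {n} (f : Fin n → ℤ) → sumFin f ≡ Sum.sum f
  sumFin≡sum {zero}  f = refl
  sumFin≡sum {suc n} f = cong (_+_ (f zero)) (sumFin≡sum (f ∘ suc))

  sum-cong : ∀ {n} {f g : Fin n → ℤ} → (∀ i → f i ≡ g i) → sumFin f ≡ sumFin g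
  sum-cong {zero}  p = refl
  sum-cong {suc n} p = cong₂ _+_ (p zero) (sum-cong (p ∘ suc))

  sum-zero : ∀ {n} {f : Fin n → ℤ} → (∀ i → f i ≡ 0ℤ) → sumFin f ≡ 0ℤ
  sum-zero {zero}  p = refl
  sum-zero {suc n} p = cong₂ _+_ (p zero) (sum-zero (p ∘ suc))

  sum-+ : ∀ {n} (f g : Fin n → ℤ) → sumFin (λ i → f i + g i) ≡ sumFin f + sumFin g
  sum-+ f g rewrite sumFin≡sum f | sumFin≡sum g | sumFin≡sum (λ i → f i + g i) = Sum.∑-distrib-+ f g

  sum-*ˡ : ∀ {n} c (f : Fin n → ℤ) → sumFin (λ i → c * f i) ≡ c * sumFin f
  sum-*ˡ c f rewrite sumFin≡sum f | sumFin≡sum (λ i → c * f i) = sym (Sum*.*-distribˡ-sum c f)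

  sum-*ʳ : ∀ {n} c (f : Fin n → ℤ) → sumFin (λ i → f i * c) ≡ sumFin f * c
  sum-*ʳ c f rewrite sumFin≡sum f | sumFin≡sum (λ i → f i * c) = sym (Sum*.*-distribʳ-sum c f)

  sum-comm : ∀ {m n} (f : Fin m → Fin n → ℤ) →
             sumFin (λ i → sumFin (f i)) ≡ sumFin (λ j → sumFin (λ i → f i j))
  sum-comm {m} {n} f = begin
    sumFin (λ i → sumFin (f i))             ≡⟨ sum-cong (λ i → sumFin≡sum (f i)) ⟩
    sumFin (λ i → Sum.sum (f i))            ≡⟨ sumFin≡sum (λ i → Sum.sum (f i)) ⟩
    Sum.sum (λ i → Sum.sum (f i))           ≡⟨ Sum.∑-comm f ⟩
    Sum.sum (λ j → Sum.sum (λ i → f i j))   ≡⟨ sumFin≡sum (λ j → Sum.sum (λ i → f i j)) ⟨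
    sumFin (λ j → Sum.sum (λ i → f i j))    ≡⟨ sum-cong (λ j → sumFin≡sum (λ i → f i j)) ⟨
    sumFin (λ j → sumFin (λ i → f i j))     ∎
    where open ≡-Reasoning

  sum-remove : ∀ {n} (i : Fin (suc n)) (f : Fin (suc n) → ℤ) →
               sumFin f ≡ f i + sumFin (f ∘ punchIn i)
  sum-remove i f rewrite sumFin≡sum f | sumFin≡sum (f ∘ punchIn i) = Sum.sum-remove {i = i} f

  sum-++ : ∀ m {n} (f : Fin (m ℕ.+ n) → ℤ) →
           sumFin f ≡ sumFin (λ i → f (i ↑ˡ n)) + sumFin (λ j → f (m ↑ʳ j))
  sum-++ zero    f = sym (ℤₚ.+-identityˡ _)
  sum-++ (suc m) f = trans (cong (_+_ (f zero)) (sum-++ m (f ∘ suc))) (sym (ℤₚ.+-assoc (f zero) _ _))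

  sum-nonneg : ∀ {n} {f : Fin n → ℤ} → (∀ i → 0ℤ ℤ.≤ f i) → 0ℤ ℤ.≤ sumFin f
  sum-nonneg {zero}  p = ℤₚ.≤-refl
  sum-nonneg {suc n} p = ℤₚ.+-mono-≤ (p zero) (sum-nonneg (p ∘ suc))

  term≤sum : ∀ {n} (f : Fin n → ℤ) → (∀ i → 0ℤ ℤ.≤ f i) → ∀ i → f i ℤ.≤ sumFin f
  term≤sum {suc n} f p i rewrite sum-remove i f =
    subst (ℤ._≤ f i + sumFin (f ∘ punchIn i)) (ℤₚ.+-identityʳ (f i))
      (ℤₚ.+-monoʳ-≤ (f i) (sum-nonneg (p ∘ punchIn i)))

  sum-const : ∀ n c → sumFin {n} (λ _ → c) ≡ + n * c
  sum-const zero    c = sym (ℤₚ.*-zeroˡ c)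
  sum-const (suc n) c = trans (cong (_+_ c) (sum-const n c)) (sym (ℤₚ.suc-* (+ n) c))

  -- Every term counts for at least `c`, and the term at `k` keeps its excess. In `rigid` the role
  -- of `c` is played by the smallest square.
  sum-lower : ∀ {n} (f : Fin n → ℤ) c → (∀ i → c ℤ.≤ f i) → ∀ k → + n * c + (f k - c) ℤ.≤ sumFin f
  sum-lower {n} f c c≤f k = subst (+ n * c + (f k - c) ℤ.≤_) total
      (ℤₚ.+-monoʳ-≤ (+ n * c) (term≤sum (λ i → f i - c) (λ i → ℤₚ.i≤j⇒0≤j-i (c≤f i)) k))
    where
    total : + n * c + sumFin (λ i → f i - c) ≡ sumFin f
    total = begin
      + n * c + sumFin (λ i → f i - c)              ≡⟨ cong (_+ sumFin (λ i → f i - c)) (sum-const n c) ⟨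
      sumFin {n} (λ _ → c) + sumFin (λ i → f i - c) ≡⟨ sum-+ (λ _ → c) (λ i → f i - c) ⟨
      sumFin (λ i → c + (f i - c))                  ≡⟨ sum-cong (λ i → ring c (f i)) ⟩
      sumFin f                                      ∎
      where
      open ≡-Reasoning
      ring : ∀ c x → c + (x - c) ≡ x
      ring = solve-∀

  sum-eˡ : ∀ {n} (i : Fin n) (f : Fin n → ℤ) → sumFin (λ j → e i j * f j) ≡ f i
  sum-eˡ {suc n} zero f = trans (cong₂ _+_ (ℤₚ.*-identityˡ (f zero)) (sum-zero (λ j → ℤₚ.*-zeroˡ (f (suc j)))))
                                (ℤₚ.+-identityʳ (f zero))
  sum-eˡ {suc n} (suc i) f = trans (cong₂ _+_ (ℤₚ.*-zeroˡ (f zero)) (sum-eˡ i (f ∘ suc))) (ℤₚ.+-identityˡ _)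

  e-sym : ∀ {n} (i j : Fin n) → e i j ≡ e j i
  e-sym zero    zero    = refl
  e-sym zero    (suc j) = refl
  e-sym (suc i) zero    = refl
  e-sym (suc i) (suc j) = e-sym i j

  e-diag : ∀ {n} (i : Fin n) → e i i ≡ 1ℤ
  e-diag zero    = refl
  e-diag (suc i) = e-diag i

  e-nonneg : ∀ {n} (i j : Fin n) → 0ℤ ℤ.≤ e i j
  e-nonneg zero    zero    = ℤ.+≤+ ℕ.z≤n
  e-nonneg zero    (suc j) = ℤ.+≤+ ℕ.z≤n
  e-nonneg (suc i) zero    = ℤ.+≤+ ℕ.z≤n
  e-nonneg (suc i) (suc j) = e-nonneg i j

  -- Bilinear forms, and representations as vectors with a prescribed Gram matrix.

  Symmetric : QForm → Set
  Symmetric L = ∀ i j → gram L i j ≡ gram L j i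

  dot-comm : ∀ {n} (x y : Vecℤ n) → dot x y ≡ dot y x
  dot-comm x y = sum-cong (λ i → ℤₚ.*-comm (x i) (y i))

  dot-congˡ : ∀ {n} {x x′ : Vecℤ n} → (∀ i → x i ≡ x′ i) → ∀ y → dot x y ≡ dot x′ y
  dot-congˡ p y = sum-cong (λ i → cong (_* y i) (p i))

  dot-lincombˡ : ∀ {n k} (c : Vecℤ k) (v : Fin k → Vecℤ n) y →
                 dot (lincomb c v) y ≡ sumFin (λ i → c i * dot (v i) y)
  dot-lincombˡ c v y = begin
    sumFin (λ j → sumFin (λ i → c i * v i j) * y j)   ≡⟨ sum-cong (λ j → sum-*ʳ (y j) (λ i → c i * v i j)) ⟨
    sumFin (λ j → sumFin (λ i → c i * v i j * y j))   ≡⟨ sum-comm (λ j i → c i * v i j * y j) ⟩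
    sumFin (λ i → sumFin (λ j → c i * v i j * y j))   ≡⟨ sum-cong (λ i → sum-cong (λ j → ℤₚ.*-assoc (c i) (v i j) (y j))) ⟩
    sumFin (λ i → sumFin (λ j → c i * (v i j * y j))) ≡⟨ sum-cong (λ i → sum-*ˡ (c i) (λ j → v i j * y j)) ⟩
    sumFin (λ i → c i * dot (v i) y)                  ∎
    where open ≡-Reasoning

  dot-combˡ : ∀ {n} a (x : Vecℤ n) b y z →
              dot (λ i → a * x i + b * y i) z ≡ a * dot x z + b * dot y z
  dot-combˡ a x b y z = begin
    sumFin (λ i → (a * x i + b * y i) * z i)
      ≡⟨ sum-cong (λ i → ring a (x i) b (y i) (z i)) ⟩
    sumFin (λ i → a * (x i * z i) + b * (y i * z i))
      ≡⟨ sum-+ (λ i → a * (x i * z i)) (λ i → b * (y i * z i)) ⟩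
    sumFin (λ i → a * (x i * z i)) + sumFin (λ i → b * (y i * z i))
      ≡⟨ cong₂ _+_ (sum-*ˡ a (λ i → x i * z i)) (sum-*ˡ b (λ i → y i * z i)) ⟩
    a * dot x z + b * dot y z ∎
    where
    open ≡-Reasoning
    ring : ∀ a x b y z → (a * x + b * y) * z ≡ a * (x * z) + b * (y * z)
    ring = solve-∀

  dot-e : ∀ {n} (i : Fin n) x → dot (e i) x ≡ x i
  dot-e = sum-eˡ

  module Bilinear (L : QForm) where

    V : Set
    V = Vecℤ (rank L)

    B-dot : ∀ x y → B L x y ≡ dot x (λ i → dot (gram L i) y)
    B-dot x y = sum-cong λ i → trans (sum-cong (λ j → ℤₚ.*-assoc (x i) (gram L i j) (y j)))
                                     (sum-*ˡ (x i) (λ j → gram L i j * y j))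

    B-congˡ : ∀ {x x′ : V} → (∀ i → x i ≡ x′ i) → ∀ y → B L x y ≡ B L x′ y
    B-congˡ p y = sum-cong (λ i → sum-cong (λ j → cong (λ t → t * gram L i j * y j) (p i)))

    B-congʳ : ∀ x {y y′ : V} → (∀ i → y i ≡ y′ i) → B L x y ≡ B L x y′
    B-congʳ x p = sum-cong (λ i → sum-cong (λ j → cong (x i * gram L i j *_) (p j)))

    B-zeroˡ : ∀ {x : V} → (∀ i → x i ≡ 0ℤ) → ∀ y → B L x y ≡ 0ℤ
    B-zeroˡ x≡0 y = sum-zero (λ i → sum-zero (λ j → cong (λ t → t * gram L i j * y j) (x≡0 i)))

    B-combˡ : ∀ a (x : V) b y z → B L (λ i → a * x i + b * y i) z ≡ a * B L x z + b * B L y z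
    B-combˡ a x b y z = begin
      B L (λ i → a * x i + b * y i) z      ≡⟨ B-dot (λ i → a * x i + b * y i) z ⟩
      dot (λ i → a * x i + b * y i) Gz     ≡⟨ dot-combˡ a x b y Gz ⟩
      a * dot x Gz + b * dot y Gz          ≡⟨ cong₂ (λ s t → a * s + b * t) (B-dot x z) (B-dot y z) ⟨
      a * B L x z + b * B L y z            ∎
      where
      open ≡-Reasoning
      Gz : V
      Gz i = dot (gram L i) z

    B-lincombˡ : ∀ {k} (c : Vecℤ k) (v : Fin k → V) y →
                 B L (lincomb c v) y ≡ sumFin (λ i → c i * B L (v i) y)
    B-lincombˡ c v y = begin
      B L (lincomb c v) y                                      ≡⟨ B-dot (lincomb c v) y ⟩
      dot (lincomb c v) (λ i → dot (gram L i) y)               ≡⟨ dot-lincombˡ c v _ ⟩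
      sumFin (λ i → c i * dot (v i) (λ i → dot (gram L i) y))  ≡⟨ sum-cong (λ i → cong (c i *_) (B-dot (v i) y)) ⟨
      sumFin (λ i → c i * B L (v i) y)                         ∎
      where open ≡-Reasoning

    Q-cong : ∀ {x x′ : V} → (∀ i → x i ≡ x′ i) → Q L x ≡ Q L x′
    Q-cong {x} {x′} p = trans (B-congˡ p x) (B-congʳ x′ p)

    module Sym (G-sym : Symmetric L) where

      B-sym : ∀ x y → B L x y ≡ B L y x
      B-sym x y = begin
        sumFin (λ i → sumFin (λ j → x i * gram L i j * y j)) ≡⟨ sum-comm (λ i j → x i * gram L i j * y j) ⟩
        sumFin (λ j → sumFin (λ i → x i * gram L i j * y j)) ≡⟨ sum-cong (λ j → sum-cong (λ i → swap i j)) ⟩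
        sumFin (λ j → sumFin (λ i → y j * gram L j i * x i)) ∎
        where
        open ≡-Reasoning
        ring : ∀ a b c → a * b * c ≡ c * b * a
        ring = solve-∀
        swap : ∀ i j → x i * gram L i j * y j ≡ y j * gram L j i * x i
        swap i j = trans (ring (x i) (gram L i j) (y j)) (cong (λ g → y j * g * x i) (G-sym i j))

      B-combʳ : ∀ z a (x : V) b y → B L z (λ i → a * x i + b * y i) ≡ a * B L z x + b * B L z y
      B-combʳ z a x b y = trans (B-sym z _)
        (trans (B-combˡ a x b y z) (cong₂ (λ s t → a * s + b * t) (B-sym x z) (B-sym y z)))

      B-lincombʳ : ∀ {k} y (c : Vecℤ k) (v : Fin k → V) →
                   B L y (lincomb c v) ≡ sumFin (λ i → c i * B L y (v i))
      B-lincombʳ y c v = trans (B-sym y _)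
        (trans (B-lincombˡ c v y) (sum-cong (λ i → cong (c i *_) (B-sym (v i) y))))

      Q-comb : ∀ a (x : V) b y → Q L (λ i → a * x i + b * y i)
                               ≡ a * a * Q L x + + 2 * a * b * B L x y + b * b * Q L y
      Q-comb a x b y = begin
        B L w w
          ≡⟨ B-combˡ a x b y w ⟩
        a * B L x w + b * B L y w
          ≡⟨ cong₂ (λ s t → a * s + b * t) (B-combʳ x a x b y) (B-combʳ y a x b y) ⟩
        a * (a * Q L x + b * B L x y) + b * (a * B L y x + b * Q L y)
          ≡⟨ cong (λ t → a * (a * Q L x + b * B L x y) + b * (a * t + b * Q L y)) (B-sym y x) ⟩
        a * (a * Q L x + b * B L x y) + b * (a * B L x y + b * Q L y)
          ≡⟨ ring a b (Q L x) (B L x y) (Q L y) ⟩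
        a * a * Q L x + + 2 * a * b * B L x y + b * b * Q L y ∎
        where
        open ≡-Reasoning
        w : V
        w i = a * x i + b * y i
        ring : ∀ a b p q r → a * (a * p + b * q) + b * (a * q + b * r) ≡ a * a * p + + 2 * a * b * q + b * b * r
        ring = solve-∀

      -- The vectors `w` are the columns of `T`, so Gram matrices alone decide. Every representation
      -- constructed below is obtained this way.
      represents : ∀ (M : QForm) (w : Fin (rank M) → V) →
                   (∀ i j → B L (w i) (w j) ≡ gram M i j) → Represents L M
      represents M w gram≡ = T , λ x → begin
        B L (apply T x) (apply T x)
          ≡⟨ Q-cong (T≡ x) ⟩
        B L (lincomb x w) (lincomb x w)
          ≡⟨ B-lincombˡ x w (lincomb x w) ⟩
        sumFin (λ i → x i * B L (w i) (lincomb x w))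
          ≡⟨ sum-cong (λ i → cong (x i *_) (B-lincombʳ (w i) x w)) ⟩
        sumFin (λ i → x i * sumFin (λ j → x j * B L (w i) (w j)))
          ≡⟨ sum-cong (λ i → sum-*ˡ (x i) (λ j → x j * B L (w i) (w j))) ⟨
        sumFin (λ i → sumFin (λ j → x i * (x j * B L (w i) (w j))))
          ≡⟨ sum-cong (λ i → sum-cong (λ j → entry x i j)) ⟩
        Q M x ∎
        where
        open ≡-Reasoning
        T : Fin (rank L) → Fin (rank M) → ℤ
        T i j = w j i
        T≡ : ∀ x i → apply T x i ≡ lincomb x w i
        T≡ x i = sum-cong (λ j → ℤₚ.*-comm (w j i) (x j))
        ring : ∀ a b g → a * (b * g) ≡ a * g * b
        ring = solve-∀
        entry : ∀ x i j → x i * (x j * B L (w i) (w j)) ≡ x i * gram M i j * x j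
        entry x i j = trans (ring (x i) (x j) _) (cong (λ g → x i * g * x j) (gram≡ i j))

  gram-e : ∀ M i j → B M (e i) (e j) ≡ gram M i j
  gram-e M i j = begin
    B M (e i) (e j)                        ≡⟨ Bilinear.B-dot M (e i) (e j) ⟩
    dot (e i) (λ k → dot (gram M k) (e j)) ≡⟨ dot-e i _ ⟩
    dot (gram M i) (e j)                   ≡⟨ dot-comm (gram M i) (e j) ⟩
    dot (e j) (gram M i)                   ≡⟨ dot-e j _ ⟩
    gram M i j                             ∎
    where open ≡-Reasoning

  -- Polarisation: an isometry in the sense of Q preserves B.
  represents⇒vectors : ∀ {L M} → Symmetric L → Symmetric M → Represents L M →
    Σ (Fin (rank M) → Vecℤ (rank L)) λ w → ∀ i j → B L (w i) (w j) ≡ gram M i j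
  represents⇒vectors {L} {M} symL symM (T , isometry) = w , λ i j → trans (B-w i j) (gram-e M i j)
    where
    module BL = Bilinear L
    module SL = BL.Sym symL
    module BM = Bilinear M
    module SM = BM.Sym symM

    w : Fin (rank M) → Vecℤ (rank L)
    w i = apply T (e i)

    apply-+ : ∀ i j k → apply T (λ l → 1ℤ * e i l + 1ℤ * e j l) k ≡ 1ℤ * w i k + 1ℤ * w j k
    apply-+ i j k = begin
      dot (T k) (λ l → 1ℤ * e i l + 1ℤ * e j l)    ≡⟨ dot-comm (T k) (λ l → 1ℤ * e i l + 1ℤ * e j l) ⟩
      dot (λ l → 1ℤ * e i l + 1ℤ * e j l) (T k)    ≡⟨ dot-combˡ 1ℤ (e i) 1ℤ (e j) (T k) ⟩
      1ℤ * dot (e i) (T k) + 1ℤ * dot (e j) (T k)  ≡⟨ cong₂ (λ s t → 1ℤ * s + 1ℤ * t) (dot-comm (e i) (T k)) (dot-comm (e j) (T k)) ⟩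
      1ℤ * w i k + 1ℤ * w j k                      ∎
      where open ≡-Reasoning

    -- The factors `1ℤ` are kept so that both sides are literally instances of `Q-comb`.
    cancel : ∀ a b c d → 1ℤ * 1ℤ * a + + 2 * 1ℤ * 1ℤ * b + 1ℤ * 1ℤ * c
                       ≡ 1ℤ * 1ℤ * a + + 2 * 1ℤ * 1ℤ * d + 1ℤ * 1ℤ * c → b ≡ d
    cancel a b c d eq = ℤₚ.*-cancelˡ-≡ (+ 2) b d (begin
      + 2 * b                                                             ≡⟨ ring a b c ⟩
      1ℤ * 1ℤ * a + + 2 * 1ℤ * 1ℤ * b + 1ℤ * 1ℤ * c - (a + c)             ≡⟨ cong (_- (a + c)) eq ⟩
      1ℤ * 1ℤ * a + + 2 * 1ℤ * 1ℤ * d + 1ℤ * 1ℤ * c - (a + c)             ≡⟨ ring a d c ⟨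
      + 2 * d                                                             ∎)
      where
      open ≡-Reasoning
      ring : ∀ a b c → + 2 * b ≡ 1ℤ * 1ℤ * a + + 2 * 1ℤ * 1ℤ * b + 1ℤ * 1ℤ * c - (a + c)
      ring = solve-∀

    B-w : ∀ i j → B L (w i) (w j) ≡ B M (e i) (e j)
    B-w i j = cancel (Q L (w i)) _ (Q L (w j)) _ (begin
      1ℤ * 1ℤ * Q L (w i) + + 2 * 1ℤ * 1ℤ * B L (w i) (w j) + 1ℤ * 1ℤ * Q L (w j)
        ≡⟨ SL.Q-comb 1ℤ (w i) 1ℤ (w j) ⟨
      Q L (λ k → 1ℤ * w i k + 1ℤ * w j k)
        ≡⟨ BL.Q-cong (apply-+ i j) ⟨
      Q L (apply T (λ l → 1ℤ * e i l + 1ℤ * e j l))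
        ≡⟨ isometry _ ⟩
      Q M (λ l → 1ℤ * e i l + 1ℤ * e j l)
        ≡⟨ SM.Q-comb 1ℤ (e i) 1ℤ (e j) ⟩
      1ℤ * 1ℤ * Q M (e i) + + 2 * 1ℤ * 1ℤ * B M (e i) (e j) + 1ℤ * 1ℤ * Q M (e j)
        ≡⟨ cong₂ (λ s t → 1ℤ * 1ℤ * s + + 2 * 1ℤ * 1ℤ * B M (e i) (e j) + 1ℤ * 1ℤ * t) (isometry (e i)) (isometry (e j)) ⟨
      1ℤ * 1ℤ * Q L (w i) + + 2 * 1ℤ * 1ℤ * B M (e i) (e j) + 1ℤ * 1ℤ * Q L (w j) ∎)
      where open ≡-Reasoning

  -- Fraction-free Gaussian elimination: clear the first row with a nonzero pivot.
  kernel : ∀ {m k} (T : Fin m → Fin k → ℤ) → m ℕ.< k →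
           Σ (Vecℤ k) λ x → (∃ λ i → x i ≢ 0ℤ) × (∀ i → apply T x i ≡ 0ℤ)
  kernel {zero} {suc k} T m<k = (λ _ → 1ℤ) , (zero , λ ()) , λ ()
  kernel {suc m} {suc k} T (ℕ.s≤s m<k) with Finₚ.any? (λ j → ¬? (T zero j ℤ.≟ 0ℤ))
  ... | no ¬pivot = let x , x≢0 , Tx≡0 = kernel (T ∘ suc) (ℕₚ.m<n⇒m<1+n m<k) in
        x , x≢0 , λ { zero    → sum-zero (λ j → cong (_* x j) (row≡0 j))
                    ; (suc i) → Tx≡0 i }
    where
    row≡0 : ∀ j → T zero j ≡ 0ℤ
    row≡0 j = decidable-stable (T zero j ℤ.≟ 0ℤ) (λ p → ¬pivot (j , p))
  ... | yes (j , a≢0) with kernel T′ m<k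
    where
    T′ : Fin m → Fin k → ℤ
    T′ i l = T zero j * T (suc i) (punchIn j l) - T (suc i) j * T zero (punchIn j l)
  ... | y , (l , yl≢0) , T′y≡0 = x , (punchIn j l , x≢0) , Tx≡0
    where
    open ≡-Reasoning
    a : ℤ
    a = T zero j
    -- With the other coordinates scaled by the pivot `a`, this value solves the first equation
    -- without division.
    xj : ℤ
    xj = - sumFin (λ l → T zero (punchIn j l) * y l)
    x : Vecℤ (suc k)
    x = Vec.insertAt (λ l → a * y l) j xj
    x-punchIn : ∀ l → x (punchIn j l) ≡ a * y l
    x-punchIn = Vecₚ.insertAt-punchIn (λ l → a * y l) j xj
    x≢0 : x (punchIn j l) ≢ 0ℤ
    x≢0 eq = [ a≢0 , yl≢0 ] (ℤₚ.i*j≡0⇒i≡0∨j≡0 a (trans (sym (x-punchIn l)) eq))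
    split : ∀ i → apply T x i ≡ T i j * xj + a * sumFin (λ l → T i (punchIn j l) * y l)
    split i = begin
      sumFin (λ l → T i l * x l)
        ≡⟨ sum-remove j (λ l → T i l * x l) ⟩
      T i j * x j + sumFin (λ l → T i (punchIn j l) * x (punchIn j l))
        ≡⟨ cong₂ (λ s t → T i j * s + t) (Vecₚ.insertAt-lookup (λ l → a * y l) j xj)
                 (sum-cong λ l → trans (cong (T i (punchIn j l) *_) (x-punchIn l)) (ring (T i (punchIn j l)) a (y l))) ⟩
      T i j * xj + sumFin (λ l → a * (T i (punchIn j l) * y l))
        ≡⟨ cong (_+_ (T i j * xj)) (sum-*ˡ a (λ l → T i (punchIn j l) * y l)) ⟩
      T i j * xj + a * sumFin (λ l → T i (punchIn j l) * y l) ∎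
      where
      ring : ∀ t a y → t * (a * y) ≡ a * (t * y)
      ring = solve-∀
    Tx≡0 : ∀ i → apply T x i ≡ 0ℤ
    Tx≡0 zero = trans (split zero) (ring a (sumFin (λ l → T zero (punchIn j l) * y l)))
      where
      ring : ∀ a s → a * - s + a * s ≡ 0ℤ
      ring = solve-∀
    Tx≡0 (suc i) = begin
      apply T x (suc i)
        ≡⟨ split (suc i) ⟩
      T (suc i) j * xj + a * sumFin (λ l → T (suc i) (punchIn j l) * y l)
        ≡⟨ ring₁ (T (suc i) j) _ a _ ⟩
      a * sumFin (λ l → T (suc i) (punchIn j l) * y l) + (- T (suc i) j) * sumFin (λ l → T zero (punchIn j l) * y l)
        ≡⟨ dot-combˡ a (λ l → T (suc i) (punchIn j l)) (- T (suc i) j) (λ l → T zero (punchIn j l)) y ⟨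
      sumFin (λ l → (a * T (suc i) (punchIn j l) + (- T (suc i) j) * T zero (punchIn j l)) * y l)
        ≡⟨ sum-cong (λ l → cong (_* y l) (ring₂ a (T (suc i) (punchIn j l)) (T (suc i) j) (T zero (punchIn j l)))) ⟩
      sumFin (λ l → (a * T (suc i) (punchIn j l) - T (suc i) j * T zero (punchIn j l)) * y l)
        ≡⟨ T′y≡0 i ⟩
      0ℤ ∎
      where
      ring₁ : ∀ t s a r → t * - s + a * r ≡ a * r + (- t) * s
      ring₁ = solve-∀
      ring₂ : ∀ a b c d → a * b + (- c) * d ≡ a * b - c * d
      ring₂ = solve-∀

  Anisotropic : QForm → Set
  Anisotropic M = ∀ x → Q M x ≡ 0ℤ → ∀ i → x i ≡ 0ℤ

  -- A nonzero kernel vector of `T` would be isotropic for `M`, since its value equals that of the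
  -- zero vector of `L`.
  represents⇒rank≤ : ∀ {L M} → Anisotropic M → Represents L M → rank M ℕ.≤ rank L
  represents⇒rank≤ {L} {M} aniso (T , isometry) = ℕₚ.≮⇒≥ λ rankL<rankM →
    let x , (i , xi≢0) , Tx≡0 = kernel T rankL<rankM in
    xi≢0 (aniso x (trans (sym (isometry x)) (Bilinear.B-zeroˡ L Tx≡0 _)) i)

  -- Integer rows with congruent entries and a small sum of squares.

  argmin : ∀ {n} (f : Fin (suc n) → ℕ) → ∃ λ i → ∀ j → f i ℕ.≤ f j
  argmin {zero}  f = zero , λ { zero → ℕₚ.≤-refl }
  argmin {suc n} f with argmin (f ∘ suc)
  ... | i , f[i]≤ with ℕₚ.≤-total (f zero) (f (suc i))
  ... | inj₁ f0≤ = zero , λ { zero → ℕₚ.≤-refl ; (suc j) → ℕₚ.≤-trans f0≤ (f[i]≤ j) }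
  ... | inj₂ ≤f0 = suc i , λ { zero → ≤f0 ; (suc j) → f[i]≤ j }

  square-abs : ∀ i → i * i ≡ + (∣ i ∣ ℕ.* ∣ i ∣)
  square-abs (+ n)        = sym (ℤₚ.pos-* n n)
  square-abs ℤ.-[1+ n ]   = refl

  square-nonneg : ∀ i → 0ℤ ℤ.≤ i * i
  square-nonneg i rewrite square-abs i = ℤ.+≤+ ℕ.z≤n

  squares≤⇒abs≤ : ∀ {n} (Y : Fin n → ℤ) N → sumFin (λ i → Y i * Y i) ℤ.≤ + (N ℕ.* N) → ∀ i → ∣ Y i ∣ ℕ.≤ N
  squares≤⇒abs≤ Y N ΣY²≤N² i = ℕₚ.≮⇒≥ λ N<∣Yi∣ → ℕₚ.<⇒≱ (ℕₚ.*-mono-< N<∣Yi∣ N<∣Yi∣)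
    (ℤₚ.drop‿+≤+ (subst (ℤ._≤ + (N ℕ.* N)) (square-abs (Y i))
      (ℤₚ.≤-trans (term≤sum (λ i → Y i * Y i) (λ i → square-nonneg (Y i)) i) ΣY²≤N²)))

  few-squares⇒zero : ∀ {n} (Y : Fin n → ℤ) → sumFin (λ i → Y i * Y i) ℤ.< + n → ∃ λ i → Y i ≡ 0ℤ
  few-squares⇒zero {n} Y ΣY²<n with Finₚ.any? (λ i → Y i ℤ.≟ 0ℤ)
  ... | yes zero∃ = zero∃
  ... | no  nozero = contradiction ΣY²<n (ℤₚ.≤⇒≯ (subst₂ ℤ._≤_ total refl (sum-mono 1≤Y²)))
    where
    sum-mono : ∀ {m} {f g : Fin m → ℤ} → (∀ i → f i ℤ.≤ g i) → sumFin f ℤ.≤ sumFin g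
    sum-mono {zero}  p = ℤₚ.≤-refl
    sum-mono {suc m} p = ℤₚ.+-mono-≤ (p zero) (sum-mono (p ∘ suc))
    total : sumFin {n} (λ _ → 1ℤ) ≡ + n
    total = trans (sum-const n 1ℤ) (ℤₚ.*-identityʳ (+ n))
    1≤Y² : ∀ i → 1ℤ ℤ.≤ Y i * Y i
    1≤Y² i rewrite square-abs (Y i) =
      ℤ.+≤+ (ℕₚ.*-mono-≤ 1≤∣Yi∣ 1≤∣Yi∣)
      where
      1≤∣Yi∣ : 1 ℕ.≤ ∣ Y i ∣
      1≤∣Yi∣ = ℕₚ.n≢0⇒n>0 (λ eq → nozero (i , ℤₚ.∣i∣≡0⇒i≡0 eq))

  private
    -- Put `N = s + d`, so that `y ≥ d`. The left side exceeds the right by at least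
    -- `2ds(s - 1) + s²(2s - 1)`, which is positive for `s ≥ 1`; `ring` is this identity with
    -- `s = t + 1`.
    gap-bound : ∀ n s y N → 1 ℕ.≤ s → s ℕ.≤ N → N ℕ.≤ y ℕ.+ s → 2 ℕ.* N ℕ.< n →
                ¬ n ℕ.* (s ℕ.* s) ℕ.+ y ℕ.* y ℕ.≤ N ℕ.* N ℕ.+ s ℕ.* s
    gap-bound n (suc t) y N _ s≤N N≤y+s 2N<n bound with ℕₚ.m≤n⇒∃[o]m+o≡n s≤N
    ... | d , refl = ℕₚ.<⇒≱ (subst (N ℕ.* N ℕ.+ s ℕ.* s ℕ.<_) (sym (ring t d)) (ℕ.s≤s (ℕₚ.m≤m+n _ _)))
      (ℕₚ.≤-trans (ℕₚ.+-mono-≤ (ℕₚ.*-monoˡ-≤ (s ℕ.* s) 2N<n) (ℕₚ.*-mono-≤ d≤y d≤y)) bound)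
      where
      s : ℕ
      s = suc t
      d≤y : d ℕ.≤ y
      d≤y = ℕₚ.+-cancelˡ-≤ s d y (subst (s ℕ.+ d ℕ.≤_) (ℕₚ.+-comm y s) N≤y+s)
      ring : ∀ t d → suc (2 ℕ.* (suc t ℕ.+ d)) ℕ.* (suc t ℕ.* suc t) ℕ.+ d ℕ.* d ≡
             suc ((suc t ℕ.+ d) ℕ.* (suc t ℕ.+ d) ℕ.+ suc t ℕ.* suc t
                  ℕ.+ (2 ℕ.* d ℕ.* (suc t ℕ.* t) ℕ.+ t ℕ.* (2 ℕ.* t ℕ.* t ℕ.+ 5 ℕ.* t ℕ.+ 4)))
      ring = ℕRing.solve-∀

  -- If Y k ≠ Y i with |Y i| = s minimal, then |Y k| ≥ N - s, so that
  -- n s² - s² + (N - s)² ≤ N², which forces n ≤ 2 N unless s = 0 and |Y k| = N.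
  rigid : ∀ {n} (Y : Fin n → ℤ) N → 2 ℕ.* N ℕ.< n → (∀ i j → + N ∣ Y i - Y j) →
          sumFin (λ i → Y i * Y i) ℤ.≤ + (N ℕ.* N) → (∀ i → ∣ Y i ∣ ≢ N) → ∀ i j → Y i ≡ Y j
  rigid {suc n} Y N 2N<n cong[N] ΣY²≤N² ∣Y∣≢N i j = trans (≡min i) (sym (≡min j))
    where
    i₀ : Fin (suc n)
    i₀ = proj₁ (argmin (λ i → ∣ Y i ∣))
    s : ℕ
    s = ∣ Y i₀ ∣
    s≤ : ∀ k → s ℕ.≤ ∣ Y k ∣
    s≤ = proj₂ (argmin (λ i → ∣ Y i ∣))
    ≤N : ∀ k → ∣ Y k ∣ ℕ.≤ N
    ≤N = squares≤⇒abs≤ Y N ΣY²≤N²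

    bound : ∀ k → suc n ℕ.* (s ℕ.* s) ℕ.+ ∣ Y k ∣ ℕ.* ∣ Y k ∣ ℕ.≤ N ℕ.* N ℕ.+ s ℕ.* s
    bound k = ℤₚ.drop‿+≤+ (begin
      + (suc n ℕ.* (s ℕ.* s) ℕ.+ ∣ Y k ∣ ℕ.* ∣ Y k ∣)
        ≡⟨ cong (ℤ._+ + (∣ Y k ∣ ℕ.* ∣ Y k ∣)) (ℤₚ.pos-* (suc n) (s ℕ.* s)) ⟩
      + suc n * + (s ℕ.* s) + + (∣ Y k ∣ ℕ.* ∣ Y k ∣)
        ≡⟨ cong (_+_ (+ suc n * + (s ℕ.* s))) (square-abs (Y k)) ⟨
      + suc n * + (s ℕ.* s) + Y k * Y k
        ≡⟨ ring (+ suc n * + (s ℕ.* s)) (Y k * Y k) (+ (s ℕ.* s)) ⟩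
      + suc n * + (s ℕ.* s) + (Y k * Y k - + (s ℕ.* s)) + + (s ℕ.* s)
        ≤⟨ ℤₚ.+-monoˡ-≤ (+ (s ℕ.* s)) (sum-lower (λ i → Y i * Y i) (+ (s ℕ.* s)) s²≤ k) ⟩
      sumFin (λ i → Y i * Y i) + + (s ℕ.* s)
        ≤⟨ ℤₚ.+-monoˡ-≤ (+ (s ℕ.* s)) ΣY²≤N² ⟩
      + (N ℕ.* N ℕ.+ s ℕ.* s) ∎)
      where
      open ℤₚ.≤-Reasoning
      ring : ∀ a b c → a + b ≡ a + (b - c) + c
      ring = solve-∀
      s²≤ : ∀ i → + (s ℕ.* s) ℤ.≤ Y i * Y i
      s²≤ i rewrite square-abs (Y i) = ℤ.+≤+ (ℕₚ.*-mono-≤ (s≤ i) (s≤ i))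

    ≡min : ∀ k → Y k ≡ Y i₀
    ≡min k with Y k ℤ.≟ Y i₀
    ... | yes eq = eq
    ... | no neq = contradiction (bound k) (gap-bound (suc n) s ∣ Y k ∣ N 1≤s (≤N i₀) N≤y+s 2N<n)
      where
      instance
        Δ≢0 : ℕ.NonZero ∣ Y k - Y i₀ ∣
        Δ≢0 = ℕ.≢-nonZero (λ eq → neq (ℤₚ.i-j≡0⇒i≡j _ _ (ℤₚ.∣i∣≡0⇒i≡0 eq)))
      -- Here `Y k` and `Y i₀` differ by a nonzero multiple of `N`.
      N≤y+s : N ℕ.≤ ∣ Y k ∣ ℕ.+ s
      N≤y+s = ℕₚ.≤-trans (ℕ∣.∣⇒≤ (∣⇒∣ᵤ (cong[N] k i₀))) (ℤₚ.∣i-j∣≤∣i∣+∣j∣ (Y k) (Y i₀))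
      y<N : ∣ Y k ∣ ℕ.< N
      y<N = ℕₚ.≤∧≢⇒< (≤N k) (∣Y∣≢N k)
      1≤s : 1 ℕ.≤ s
      1≤s = ℕₚ.n≢0⇒n>0 (λ s≡0 → ℕₚ.<⇒≱ y<N
        (subst (N ℕ.≤_) (trans (cong (∣ Y k ∣ ℕ.+_) s≡0) (ℕₚ.+-identityʳ _)) N≤y+s))

  -- The vectors u i / p form an orthonormal basis of (a copy of) I n in L ⊗ ℚ;
  -- L contains u i and the differences (u i - u j) / p = r i - r j.
  record Frame (L : QForm) (n p : ℕ) : Set where
    field
      u r        : Fin n → Vecℤ (rank L)
      shift      : ∀ i j k → + p * (r i k - r j k) ≡ u i k - u j k
      orthogonal : ∀ i j → B L (u i) (u j) ≡ + p * + p * e i j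

  bézout : ∀ {p q} → Coprime p q → ∃ λ α → ∃ λ β → α * + p + β * + q ≡ 1ℤ
  bézout {p} {q} coprime with coprime-Bézout coprime
  ... | Bézout.+- x y eq = + x , - + y , (begin
    + x * + p + - + y * + q         ≡⟨ ring (+ x * + p) (+ y) (+ q) ⟩
    + x * + p - + y * + q           ≡⟨ cong (λ t → t - + y * + q) (trans (sym (ℤₚ.pos-* x p)) (cong +_ (sym eq))) ⟩
    1ℤ + + (y ℕ.* q) - + y * + q    ≡⟨ cong (λ t → 1ℤ + t - + y * + q) (ℤₚ.pos-* y q) ⟩
    1ℤ + + y * + q - + y * + q      ≡⟨ cancel (+ y * + q) ⟩
    1ℤ                              ∎)
    where
    open ≡-Reasoning
    ring : ∀ a y q → a + - y * q ≡ a - y * q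
    ring = solve-∀
    cancel : ∀ a → 1ℤ + a - a ≡ 1ℤ
    cancel = solve-∀
  ... | Bézout.-+ x y eq = - + x , + y , (begin
    - + x * + p + + y * + q           ≡⟨ cong (_+_ (- + x * + p)) (trans (sym (ℤₚ.pos-* y q)) (cong +_ (sym eq))) ⟩
    - + x * + p + (1ℤ + + (x ℕ.* p))  ≡⟨ cong (λ t → - + x * + p + (1ℤ + t)) (ℤₚ.pos-* x p) ⟩
    - + x * + p + (1ℤ + + x * + p)    ≡⟨ cancel (+ x) (+ p) ⟩
    1ℤ                                ∎)
    where
    open ≡-Reasoning
    cancel : ∀ x p → - x * p + (1ℤ + x * p) ≡ 1ℤ
    cancel = solve-∀

  -- Inner products with a frame in a positive definite lattice.

  module Frames {L : QForm} (isLattice : IsLattice L) where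

    open Bilinear L
    open Sym (proj₁ isLattice)

    private
      _∙_ : V → V → ℤ
      _∙_ = B L
      infix 8 _∙_

    Q-nonneg : ∀ x → 0ℤ ℤ.≤ Q L x
    Q-nonneg x with Finₚ.all? (λ i → x i ℤ.≟ 0ℤ)
    ... | yes x≡0 = ℤₚ.≤-reflexive (sym (B-zeroˡ x≡0 x))
    ... | no  x≢0 = ℤₚ.<⇒≤ (proj₂ isLattice x x≢0)

    Q≡0⇒≡0 : Anisotropic L
    Q≡0⇒≡0 x Qx≡0 with Finₚ.all? (λ i → x i ℤ.≟ 0ℤ)
    ... | yes x≡0 = x≡0
    ... | no  x≢0 = contradiction (sym Qx≡0) (ℤₚ.<⇒≢ (proj₂ isLattice x x≢0))

    B-subˡ : ∀ x y z → (λ k → x k - y k) ∙ z ≡ x ∙ z - y ∙ z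
    B-subˡ x y z = begin
      (λ k → x k - y k) ∙ z                     ≡⟨ B-congˡ (λ k → ring (x k) (y k)) z ⟩
      (λ k → 1ℤ * x k + (- 1ℤ) * y k) ∙ z       ≡⟨ B-combˡ 1ℤ x (- 1ℤ) y z ⟩
      1ℤ * x ∙ z + (- 1ℤ) * y ∙ z               ≡⟨ ring (x ∙ z) (y ∙ z) ⟨
      x ∙ z - y ∙ z                             ∎
      where
      open ≡-Reasoning
      ring : ∀ a b → a - b ≡ 1ℤ * a + (- 1ℤ) * b
      ring = solve-∀

    B-subʳ : ∀ z x y → z ∙ (λ k → x k - y k) ≡ z ∙ x - z ∙ y
    B-subʳ z x y = begin
      z ∙ (λ k → x k - y k)   ≡⟨ B-sym z (λ k → x k - y k) ⟩
      (λ k → x k - y k) ∙ z   ≡⟨ B-subˡ x y z ⟩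
      x ∙ z - y ∙ z           ≡⟨ cong₂ _-_ (B-sym x z) (B-sym y z) ⟩
      z ∙ x - z ∙ y           ∎
      where open ≡-Reasoning

    B-*ˡ : ∀ a x z → (λ k → a * x k) ∙ z ≡ a * x ∙ z
    B-*ˡ a x z = begin
      (λ k → a * x k) ∙ z             ≡⟨ B-congˡ (λ k → ring a (x k)) z ⟩
      (λ k → a * x k + 0ℤ * x k) ∙ z  ≡⟨ B-combˡ a x 0ℤ x z ⟩
      a * x ∙ z + 0ℤ * x ∙ z          ≡⟨ ring a (x ∙ z) ⟨
      a * x ∙ z                       ∎
      where
      open ≡-Reasoning
      ring : ∀ a b → a * b ≡ a * b + 0ℤ * b
      ring = solve-∀

    B-*ʳ : ∀ a z x → z ∙ (λ k → a * x k) ≡ a * z ∙ x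
    B-*ʳ a z x = trans (B-sym z (λ k → a * x k)) (trans (B-*ˡ a x z) (cong (a *_) (B-sym x z)))

    module _ {n p} .{{_ : ℕ.NonZero p}} (F : Frame L n p) where

      open Frame F

      private
        P : ℤ
        P = + p
        instance
          P≢0 : ℤ.NonZero P
          P≢0 = ℤ.≢-nonZero (λ eq → ℕ.≢-nonZero⁻¹ p (ℤₚ.+-injective eq))
          PP≢0 : ℤ.NonZero (P * P)
          PP≢0 = ℤₚ.i*j≢0 P P

      shift-B : ∀ z i j → P * z ∙ (λ k → r i k - r j k) ≡ z ∙ u i - z ∙ u j
      shift-B z i j = begin
        P * z ∙ (λ k → r i k - r j k)      ≡⟨ B-*ʳ P z (λ k → r i k - r j k) ⟨
        z ∙ (λ k → P * (r i k - r j k))    ≡⟨ B-congʳ z (shift i j) ⟩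
        z ∙ (λ k → u i k - u j k)          ≡⟨ B-subʳ z (u i) (u j) ⟩
        z ∙ u i - z ∙ u j                  ∎
        where open ≡-Reasoning

      u∙lincomb : ∀ i d → u i ∙ lincomb d u ≡ P * P * d i
      u∙lincomb i d = begin
        u i ∙ lincomb d u                       ≡⟨ B-lincombʳ (u i) d u ⟩
        sumFin (λ j → d j * u i ∙ u j)          ≡⟨ sum-cong (λ j → trans (cong (d j *_) (orthogonal i j)) (ring (d j) P (e i j))) ⟩
        sumFin (λ j → P * P * (e i j * d j))    ≡⟨ sum-*ˡ (P * P) (λ j → e i j * d j) ⟩
        P * P * sumFin (λ j → e i j * d j)      ≡⟨ cong (P * P *_) (sum-eˡ i d) ⟩
        P * P * d i                             ∎
        where
        open ≡-Reasoning
        ring : ∀ d p e → d * (p * p * e) ≡ p * p * (e * d)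
        ring = solve-∀

      lincomb∙lincomb : ∀ c d → lincomb c u ∙ lincomb d u ≡ P * P * dot c d
      lincomb∙lincomb c d = begin
        lincomb c u ∙ lincomb d u                   ≡⟨ B-lincombˡ c u (lincomb d u) ⟩
        sumFin (λ i → c i * u i ∙ lincomb d u)      ≡⟨ sum-cong (λ i → trans (cong (c i *_) (u∙lincomb i d)) (ring (c i) P (d i))) ⟩
        sumFin (λ i → P * P * (c i * d i))          ≡⟨ sum-*ˡ (P * P) (λ i → c i * d i) ⟩
        P * P * dot c d                             ∎
        where
        open ≡-Reasoning
        ring : ∀ c p d → c * (p * p * d) ≡ p * p * (c * d)
        ring = solve-∀

      -- The hypotheses say that `c` and `d` are the coordinates of `x` and `y` in the orthonormal
      -- frame `u i / p`. The Gram matrices of `I`, `D` and `A` are all read off from this.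
      divided-dot : ∀ {x y} c d → (∀ k → P * x k ≡ lincomb c u k) → (∀ k → P * y k ≡ lincomb d u k) →
                    x ∙ y ≡ dot c d
      divided-dot {x} {y} c d px py = ℤₚ.*-cancelˡ-≡ (P * P) (x ∙ y) (dot c d) (begin
        P * P * x ∙ y                          ≡⟨ ℤₚ.*-assoc P P (x ∙ y) ⟩
        P * (P * x ∙ y)                        ≡⟨ cong (P *_) (B-*ʳ P x y) ⟨
        P * x ∙ (λ k → P * y k)                ≡⟨ B-*ˡ P x (λ k → P * y k) ⟨
        (λ k → P * x k) ∙ (λ k → P * y k)      ≡⟨ trans (B-congˡ px (λ k → P * y k)) (B-congʳ (lincomb c u) py) ⟩
        lincomb c u ∙ lincomb d u              ≡⟨ lincomb∙lincomb c d ⟩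
        P * P * dot c d                        ∎)
        where open ≡-Reasoning

      lincomb-e : ∀ i k → lincomb (e i) u k ≡ u i k
      lincomb-e i k = sum-eˡ i (λ j → u j k)

      lincomb-e-e : ∀ i j k → lincomb (λ l → e i l - e j l) u k ≡ u i k - u j k
      lincomb-e-e i j k = begin
        dot (λ l → e i l - e j l) (λ l → u l k)                   ≡⟨ dot-congˡ (λ l → ring (e i l) (e j l)) (λ l → u l k) ⟩
        dot (λ l → 1ℤ * e i l + (- 1ℤ) * e j l) (λ l → u l k)     ≡⟨ dot-combˡ 1ℤ (e i) (- 1ℤ) (e j) (λ l → u l k) ⟩
        1ℤ * lincomb (e i) u k + (- 1ℤ) * lincomb (e j) u k       ≡⟨ ring (lincomb (e i) u k) (lincomb (e j) u k) ⟨
        lincomb (e i) u k - lincomb (e j) u k                     ≡⟨ cong₂ _-_ (lincomb-e i k) (lincomb-e j k) ⟩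
        u i k - u j k                                             ∎
        where
        open ≡-Reasoning
        ring : ∀ a b → a - b ≡ 1ℤ * a + (- 1ℤ) * b
        ring = solve-∀

      root-lincomb : ∀ i j k → P * (r i k - r j k) ≡ lincomb (λ l → e i l - e j l) u k
      root-lincomb i j k = trans (shift i j k) (sym (lincomb-e-e i j k))

      -- The norm is 2 for `i ≠ j` and 0 for `i = j`; the inequality treats both at once.
      root-norm≤2 : ∀ i j → Q L (λ k → r i k - r j k) ℤ.≤ + 2
      root-norm≤2 i j = begin
        Q L (λ k → r i k - r j k)                ≡⟨ divided-dot (λ l → e i l - e j l) (λ l → e i l - e j l) (root-lincomb i j) (root-lincomb i j) ⟩
        dot (λ l → e i l - e j l) (λ l → e i l - e j l)
          ≡⟨ dot-congˡ (λ l → ring₁ (e i l) (e j l)) (λ l → e i l - e j l) ⟩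
        dot (λ l → 1ℤ * e i l + (- 1ℤ) * e j l) (λ l → e i l - e j l)
          ≡⟨ dot-combˡ 1ℤ (e i) (- 1ℤ) (e j) (λ l → e i l - e j l) ⟩
        1ℤ * dot (e i) (λ l → e i l - e j l) + (- 1ℤ) * dot (e j) (λ l → e i l - e j l)
          ≡⟨ cong₂ (λ s t → 1ℤ * s + (- 1ℤ) * t) (dot-e i (λ l → e i l - e j l)) (dot-e j (λ l → e i l - e j l)) ⟩
        1ℤ * (e i i - e j i) + (- 1ℤ) * (e i j - e j j)
          ≡⟨ cong₂ (λ s t → 1ℤ * (s - e j i) + (- 1ℤ) * (e i j - t)) (e-diag i) (e-diag j) ⟩
        1ℤ * (1ℤ - e j i) + (- 1ℤ) * (e i j - 1ℤ)
          ≡⟨ ring₂ (e i j) (e j i) ⟩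
        + 2 - (e i j + e j i)
          ≤⟨ ℤₚ.+-monoʳ-≤ (+ 2) (ℤₚ.neg-mono-≤ (ℤₚ.+-mono-≤ (e-nonneg i j) (e-nonneg j i))) ⟩
        + 2 ∎
        where
        open ℤₚ.≤-Reasoning
        ring₁ : ∀ a b → a - b ≡ 1ℤ * a + (- 1ℤ) * b
        ring₁ = solve-∀
        ring₂ : ∀ a b → 1ℤ * (1ℤ - b) + (- 1ℤ) * (a - 1ℤ) ≡ + 2 - (a + b)
        ring₂ = solve-∀

      -- The vector `w` is `p²` times the component of `z` orthogonal to the frame, and `Q L w` is
      -- `p²` times the difference of the two sides.
      bessel : ∀ z → sumFin (λ i → z ∙ u i * z ∙ u i) ℤ.≤ P * P * Q L z
      bessel z = ℤₚ.0≤i-j⇒j≤i (ℤₚ.*-cancelˡ-≤-pos 0ℤ (P * P * Q L z - S) (P * P) {{PP>0}} (begin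
        P * P * 0ℤ                               ≡⟨ ℤₚ.*-zeroʳ (P * P) ⟩
        0ℤ                                       ≤⟨ Q-nonneg w ⟩
        Q L w                                    ≡⟨ Q-comb (P * P) z (- 1ℤ) (lincomb c u) ⟩
        P * P * (P * P) * Q L z + + 2 * (P * P) * (- 1ℤ) * z ∙ lincomb c u + (- 1ℤ) * (- 1ℤ) * Q L (lincomb c u)
          ≡⟨ cong₂ (λ s t → P * P * (P * P) * Q L z + + 2 * (P * P) * (- 1ℤ) * s + (- 1ℤ) * (- 1ℤ) * t)
               (B-lincombʳ z c u) (lincomb∙lincomb c c) ⟩
        P * P * (P * P) * Q L z + + 2 * (P * P) * (- 1ℤ) * S + (- 1ℤ) * (- 1ℤ) * (P * P * S)
          ≡⟨ ring (P * P) (Q L z) S ⟩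
        P * P * (P * P * Q L z - S)              ∎))
        where
        open ℤₚ.≤-Reasoning
        c : Vecℤ n
        c i = z ∙ u i
        S : ℤ
        S = sumFin (λ i → c i * c i)
        w : V
        w k = P * P * z k + (- 1ℤ) * lincomb c u k
        PP>0 : ℤ.Positive (P * P)
        PP>0 = subst ℤ.Positive (ℤₚ.pos-* p p) (ℤ.positive (ℤ.+<+ (ℕₚ.*-mono-< (ℕ.>-nonZero⁻¹ p) (ℕ.>-nonZero⁻¹ p))))
        ring : ∀ p q s → p * p * q + + 2 * p * (- 1ℤ) * s + (- 1ℤ) * (- 1ℤ) * (p * s) ≡ p * (p * q - s)
        ring = solve-∀

      -- This is equality in Cauchy-Schwarz: the unit vectors `u i / p` and `z / q` agree up to the
      -- sign `s`, which is the vanishing of `w`. One frame vector in `L` suffices, as the others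
      -- differ from it by elements `r j - r i` of `L`.
      unit-entry⇒represents-I : ∀ {q s} z i → Coprime p q → s * s ≡ 1ℤ → Q L z ≡ + q * + q →
                                z ∙ u i ≡ s * (P * + q) → Represents L (I n)
      unit-entry⇒represents-I {q} {s} z i coprime s²≡1 Qz z∙ui =
        represents (I n) (λ j k → a k + (r j k - r i k)) λ j l →
          trans (divided-dot (e j) (e l) (λ k → trans (pa j k) (sym (lincomb-e j k)))
                                         (λ k → trans (pa l k) (sym (lincomb-e l k))))
                (trans (dot-e j (e l)) (e-sym l j))
        where
        open ≡-Reasoning
        α β : ℤ
        α = proj₁ (bézout coprime)
        β = proj₁ (proj₂ (bézout coprime))
        αp+βq≡1 : α * P + β * + q ≡ 1ℤ
        αp+βq≡1 = proj₂ (proj₂ (bézout coprime))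
        w : V
        w k = + q * u i k + (- (s * P)) * z k
        Qw≡0 : Q L w ≡ 0ℤ
        Qw≡0 = begin
          Q L w
            ≡⟨ Q-comb (+ q) (u i) (- (s * P)) z ⟩
          + q * + q * Q L (u i) + + 2 * + q * (- (s * P)) * u i ∙ z + (- (s * P)) * (- (s * P)) * Q L z
            ≡⟨ cong₂ (λ x y → + q * + q * x + + 2 * + q * (- (s * P)) * y + (- (s * P)) * (- (s * P)) * Q L z)
                 (trans (orthogonal i i) (cong (P * P *_) (e-diag i))) (trans (B-sym (u i) z) z∙ui) ⟩
          + q * + q * (P * P * 1ℤ) + + 2 * + q * (- (s * P)) * (s * (P * + q)) + (- (s * P)) * (- (s * P)) * Q L z
            ≡⟨ cong (λ x → + q * + q * (P * P * 1ℤ) + + 2 * + q * (- (s * P)) * (s * (P * + q)) + (- (s * P)) * (- (s * P)) * x) Qz ⟩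
          + q * + q * (P * P * 1ℤ) + + 2 * + q * (- (s * P)) * (s * (P * + q)) + (- (s * P)) * (- (s * P)) * (+ q * + q)
            ≡⟨ ring (+ q) P s ⟩
          + q * + q * P * P * (1ℤ - s * s)
            ≡⟨ cong (λ x → + q * + q * P * P * (1ℤ - x)) s²≡1 ⟩
          + q * + q * P * P * 0ℤ
            ≡⟨ ℤₚ.*-zeroʳ (+ q * + q * P * P) ⟩
          0ℤ ∎
          where
          ring : ∀ q p s → q * q * (p * p * 1ℤ) + + 2 * q * (- (s * p)) * (s * (p * q)) + (- (s * p)) * (- (s * p)) * (q * q)
                         ≡ q * q * p * p * (1ℤ - s * s)
          ring = solve-∀
        -- From `q u i = s p z` and `α p + β q = 1` it follows that `p a = u i`; so this is the
        -- frame vector `u i / p` itself.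
        a : V
        a k = α * u i k + β * s * z k
        pa : ∀ j k → P * (a k + (r j k - r i k)) ≡ u j k
        pa j k = begin
          P * (a k + (r j k - r i k))
            ≡⟨ ring₁ P α β s (u i k) (z k) (r j k - r i k) (+ q) ⟩
          (α * P + β * + q) * u i k - β * (+ q * u i k + (- (s * P)) * z k) + P * (r j k - r i k)
            ≡⟨ cong₂ (λ x y → x * u i k - β * y + P * (r j k - r i k)) αp+βq≡1 (Q≡0⇒≡0 w Qw≡0 k) ⟩
          1ℤ * u i k - β * 0ℤ + P * (r j k - r i k)
            ≡⟨ cong (_+_ (1ℤ * u i k - β * 0ℤ)) (shift j i k) ⟩
          1ℤ * u i k - β * 0ℤ + (u j k - u i k)
            ≡⟨ ring₂ (u i k) β (u j k) ⟩
          u j k ∎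
          where
          ring₁ : ∀ p α β s u z d q → p * (α * u + β * s * z + d)
                                    ≡ (α * p + β * q) * u - β * (q * u + (- (s * p)) * z) + p * d
          ring₁ = solve-∀
          ring₂ : ∀ u β v → 1ℤ * u - β * 0ℤ + (v - u) ≡ v
          ring₂ = solve-∀

    -- Orthogonality between frames of coprime levels when `I n` is not represented.

    module _ {n} (¬I : ¬ Represents L (I n)) where

      open Frame

      private
        2pq<n : ∀ {p q} → 2 ℕ.* p ℕ.* p ℕ.< n → 2 ℕ.* q ℕ.* q ℕ.< n → 2 ℕ.* (p ℕ.* q) ℕ.< n
        2pq<n {p} {q} 2pp<n 2qq<n with ℕₚ.≤-total p q
        ... | inj₁ p≤q = ℕₚ.≤-<-trans
                (subst (ℕ._≤ 2 ℕ.* q ℕ.* q) (ℕₚ.*-assoc 2 p q) (ℕₚ.*-monoˡ-≤ q (ℕₚ.*-monoʳ-≤ 2 p≤q))) 2qq<n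
        ... | inj₂ q≤p = ℕₚ.≤-<-trans
                (subst (ℕ._≤ 2 ℕ.* p ℕ.* p) (ℕₚ.*-assoc 2 p q) (ℕₚ.*-monoʳ-≤ (2 ℕ.* p) q≤p)) 2pp<n

      -- Here `z` is `q` times a unit vector: a vector `u l` of a frame of level `q`, or, for
      -- `q = 1`, a unit vector of `L`. This is `rigid` with `N = pq`; the absolute value `N` it
      -- excludes is the case of `unit-entry⇒represents-I`.
      constant-row : ∀ {p q} .{{_ : ℕ.NonZero p}} (F : Frame L n p) z → Coprime p q →
                     Q L z ≡ + q * + q → 2 ℕ.* (p ℕ.* q) ℕ.< n →
                     (∀ i j → + q ∣ z ∙ (λ k → r F i k - r F j k)) → ∀ i j → z ∙ u F i ≡ z ∙ u F j
      constant-row {p} {q} F z coprime Qz 2pq<n q∣ =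
        rigid (λ i → z ∙ u F i) (p ℕ.* q) 2pq<n congruent ΣY²≤N² ∣Y∣≢N
        where
        congruent : ∀ i j → + (p ℕ.* q) ∣ z ∙ u F i - z ∙ u F j
        congruent i j = subst₂ _∣_ (sym (ℤₚ.pos-* p q)) (shift-B F z i j) (*-monoʳ-∣ (+ p) (q∣ i j))
        ΣY²≤N² : sumFin (λ i → z ∙ u F i * z ∙ u F i) ℤ.≤ + (p ℕ.* q ℕ.* (p ℕ.* q))
        ΣY²≤N² = subst (sumFin (λ i → z ∙ u F i * z ∙ u F i) ℤ.≤_) (begin
          + p * + p * Q L z                  ≡⟨ cong (+ p * + p *_) Qz ⟩
          + p * + p * (+ q * + q)            ≡⟨ ring (+ p) (+ q) ⟩
          + p * + q * (+ p * + q)            ≡⟨ cong (λ t → t * t) (ℤₚ.pos-* p q) ⟨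
          + (p ℕ.* q) * + (p ℕ.* q)          ≡⟨ ℤₚ.pos-* (p ℕ.* q) (p ℕ.* q) ⟨
          + (p ℕ.* q ℕ.* (p ℕ.* q))          ∎) (bessel F z)
          where
          open ≡-Reasoning
          ring : ∀ p q → p * p * (q * q) ≡ p * q * (p * q)
          ring = solve-∀
        ∣Y∣≢N : ∀ i → ∣ z ∙ u F i ∣ ≢ p ℕ.* q
        ∣Y∣≢N i ∣Y∣≡N with ℤₚ.+∣i∣≡i⊎+∣i∣≡-i (z ∙ u F i)
        ... | inj₁ +∣Y∣≡Y = ¬I (unit-entry⇒represents-I F {s = 1ℤ} z i coprime refl Qz (begin
          z ∙ u F i           ≡⟨ +∣Y∣≡Y ⟨
          + ∣ z ∙ u F i ∣     ≡⟨ cong +_ ∣Y∣≡N ⟩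
          + (p ℕ.* q)         ≡⟨ ℤₚ.pos-* p q ⟩
          + p * + q           ≡⟨ ℤₚ.*-identityˡ (+ p * + q) ⟨
          1ℤ * (+ p * + q)    ∎))
          where open ≡-Reasoning
        ... | inj₂ +∣Y∣≡-Y = ¬I (unit-entry⇒represents-I F {s = - 1ℤ} z i coprime refl Qz (begin
          z ∙ u F i                 ≡⟨ ring (z ∙ u F i) ⟩
          (- 1ℤ) * (- (z ∙ u F i))    ≡⟨ cong ((- 1ℤ) *_) +∣Y∣≡-Y ⟨
          (- 1ℤ) * + ∣ z ∙ u F i ∣  ≡⟨ cong (λ t → (- 1ℤ) * + t) ∣Y∣≡N ⟩
          (- 1ℤ) * + (p ℕ.* q)      ≡⟨ cong ((- 1ℤ) *_) (ℤₚ.pos-* p q) ⟩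
          (- 1ℤ) * (+ p * + q)      ∎))
          where
          open ≡-Reasoning
          ring : ∀ a → a ≡ (- 1ℤ) * (- a)
          ring = solve-∀

      constant⇒∙root≡0 : ∀ {p} .{{_ : ℕ.NonZero p}} (F : Frame L n p) z →
                         (∀ i j → z ∙ u F i ≡ z ∙ u F j) → ∀ i j → z ∙ (λ k → r F i k - r F j k) ≡ 0ℤ
      constant⇒∙root≡0 {suc p} F z constant i j = ℤₚ.*-cancelˡ-≡ (+ suc p) (z ∙ (λ k → r F i k - r F j k)) 0ℤ (begin
        + suc p * z ∙ (λ k → r F i k - r F j k)  ≡⟨ shift-B F z i j ⟩
        z ∙ u F i - z ∙ u F j                    ≡⟨ ℤₚ.i≡j⇒i-j≡0 (constant i j) ⟩
        0ℤ                                       ≡⟨ ℤₚ.*-zeroʳ (+ suc p) ⟨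
        + suc p * 0ℤ                             ∎)
        where open ≡-Reasoning

      -- Subtracting the entry that vanishes turns `ρ ∙ u F i` into `p` times the inner product of
      -- `ρ` with a difference of the `r F i`, an integer.
      norm2-divisible : ∀ {p} .{{_ : ℕ.NonZero p}} (F : Frame L n p) → 2 ℕ.* p ℕ.* p ℕ.< n →
                        ∀ ρ → Q L ρ ℤ.≤ + 2 → ∀ i → + p ∣ ρ ∙ u F i
      norm2-divisible {p} F 2pp<n ρ Qρ≤2 i = divides (ρ ∙ (λ k → r F i k - r F j k)) (let open ≡-Reasoning in begin
        ρ ∙ u F i                                ≡⟨ ring (ρ ∙ u F i) ⟩
        ρ ∙ u F i - 0ℤ                           ≡⟨ cong (λ t → ρ ∙ u F i - t) (proj₂ zero∃) ⟨
        ρ ∙ u F i - ρ ∙ u F j                    ≡⟨ shift-B F ρ i j ⟨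
        + p * ρ ∙ (λ k → r F i k - r F j k)      ≡⟨ ℤₚ.*-comm (+ p) (ρ ∙ (λ k → r F i k - r F j k)) ⟩
        ρ ∙ (λ k → r F i k - r F j k) * + p      ∎)
        where
        ring : ∀ a → a ≡ a - 0ℤ
        ring = solve-∀
        bound : + p * + p * Q L ρ ℤ.≤ + (2 ℕ.* p ℕ.* p)
        bound = let open ℤₚ.≤-Reasoning in begin
          + p * + p * Q L ρ        ≡⟨ cong (_* Q L ρ) (ℤₚ.pos-* p p) ⟨
          + (p ℕ.* p) * Q L ρ      ≤⟨ ℤₚ.*-monoˡ-≤-nonNeg (+ (p ℕ.* p)) Qρ≤2 ⟩
          + (p ℕ.* p) * + 2        ≡⟨ ℤₚ.pos-* (p ℕ.* p) 2 ⟨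
          + (p ℕ.* p ℕ.* 2)        ≡⟨ cong +_ (trans (ℕₚ.*-comm (p ℕ.* p) 2) (sym (ℕₚ.*-assoc 2 p p))) ⟩
          + (2 ℕ.* p ℕ.* p)        ∎
        zero∃ : ∃ λ j → ρ ∙ u F j ≡ 0ℤ
        zero∃ = few-squares⇒zero (λ i → ρ ∙ u F i)
          (ℤₚ.≤-<-trans (ℤₚ.≤-trans (bessel F ρ) bound) (ℤ.+<+ 2pp<n))
        j : Fin n
        j = proj₁ zero∃

      frame⊥roots : ∀ {p q} .{{_ : ℕ.NonZero p}} .{{_ : ℕ.NonZero q}} (F : Frame L n p) (G : Frame L n q) →
                    Coprime p q → 2 ℕ.* p ℕ.* p ℕ.< n → 2 ℕ.* q ℕ.* q ℕ.< n →
                    ∀ l i j → u F l ∙ (λ k → r G i k - r G j k) ≡ 0ℤ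
      frame⊥roots {p} {q} F G coprime 2pp<n 2qq<n l = constant⇒∙root≡0 G (u F l)
        (constant-row G (u F l) (Coprimality.sym coprime) Qu (2pq<n {q} {p} 2qq<n 2pp<n) λ i j →
          subst (+ p ∣_) (B-sym (λ k → r G i k - r G j k) (u F l))
            (norm2-divisible F 2pp<n (λ k → r G i k - r G j k) (root-norm≤2 G i j) l))
        where
        Qu : Q L (u F l) ≡ + p * + p
        Qu = trans (orthogonal F l l) (trans (cong (+ p * + p *_) (e-diag l)) (ℤₚ.*-identityʳ (+ p * + p)))

      -- A root of `F` is a difference of vectors `u F a` divided by `p`, so `frame⊥roots` carries
      -- over to it once `p` is cancelled.
      roots⊥roots : ∀ {p q} .{{_ : ℕ.NonZero p}} .{{_ : ℕ.NonZero q}} (F : Frame L n p) (G : Frame L n q) →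
                    Coprime p q → 2 ℕ.* p ℕ.* p ℕ.< n → 2 ℕ.* q ℕ.* q ℕ.< n →
                    ∀ i′ j′ i j → (λ k → r F i′ k - r F j′ k) ∙ (λ k → r G i k - r G j k) ≡ 0ℤ
      roots⊥roots F G coprime 2pp<n 2qq<n i′ j′ i j =
        trans (B-sym (λ k → r F i′ k - r F j′ k) ρ)
          (constant⇒∙root≡0 F ρ (λ a b → trans (ρ∙u≡0 a) (sym (ρ∙u≡0 b))) i′ j′)
        where
        ρ : V
        ρ k = r G i k - r G j k
        ρ∙u≡0 : ∀ a → ρ ∙ u F a ≡ 0ℤ
        ρ∙u≡0 a = trans (B-sym ρ (u F a)) (frame⊥roots F G coprime 2pp<n 2qq<n a i j)

      -- The row is constant by the case `q = 1`, and `p² < n` leaves a zero in it. Orthogonality to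
      -- `u` itself, beyond the roots, is what the generator `u zero` of `D n` requires.
      unit⊥frame : ∀ {p} .{{_ : ℕ.NonZero p}} (F : Frame L n p) → 2 ℕ.* p ℕ.* p ℕ.< n →
                   ∀ c → Q L c ≡ 1ℤ → ∀ i → c ∙ u F i ≡ 0ℤ
      unit⊥frame {p} F 2pp<n c Qc≡1 i = let j , c∙uj≡0 = zero∃ in trans (constant i j) c∙uj≡0
        where
        1∣ : ∀ x → 1ℤ ∣ x
        1∣ x = divides x (sym (ℤₚ.*-identityʳ x))
        p*p<n : p ℕ.* p ℕ.< n
        p*p<n = ℕₚ.≤-<-trans (ℕₚ.*-monoˡ-≤ p (ℕₚ.m≤m+n p (p ℕ.+ 0))) 2pp<n
        p≤p*p : p ℕ.≤ p ℕ.* p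
        p≤p*p = ℕₚ.m≤m*n p p
        2p1<n : 2 ℕ.* (p ℕ.* 1) ℕ.< n
        2p1<n = ℕₚ.≤-<-trans (subst (2 ℕ.* (p ℕ.* 1) ℕ.≤_) (sym (ℕₚ.*-assoc 2 p p))
          (ℕₚ.*-monoʳ-≤ 2 (subst (ℕ._≤ p ℕ.* p) (sym (ℕₚ.*-identityʳ p)) p≤p*p))) 2pp<n
        constant : ∀ i j → c ∙ u F i ≡ c ∙ u F j
        constant = constant-row {q = 1} F c (Coprimality.sym (Coprimality.1-coprimeTo p)) Qc≡1 2p1<n
                     (λ i j → 1∣ (c ∙ (λ k → r F i k - r F j k)))
        zero∃ : ∃ λ j → c ∙ u F j ≡ 0ℤ
        zero∃ = few-squares⇒zero (λ i → c ∙ u F i) (begin-strict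
          sumFin (λ i → c ∙ u F i * c ∙ u F i)  ≤⟨ bessel F c ⟩
          + p * + p * Q L c                     ≡⟨ cong (+ p * + p *_) Qc≡1 ⟩
          + p * + p * 1ℤ                        ≡⟨ ℤₚ.*-identityʳ (+ p * + p) ⟩
          + p * + p                             ≡⟨ ℤₚ.pos-* p p ⟨
          + (p ℕ.* p)                           <⟨ ℤ.+<+ p*p<n ⟩
          + n                                   ∎)
          where open ℤₚ.≤-Reasoning

  -- Spanned lattices, and definiteness of the summands and of their orthogonal sum.

  isometry-lincomb : ∀ {L n k} → Symmetric L → (w : Fin k → Vecℤ (rank L)) (v : Fin k → Vecℤ n) →
                     (∀ i j → B L (w i) (w j) ≡ dot (v i) (v j)) →
                     ∀ c d → B L (lincomb c w) (lincomb d w) ≡ dot (lincomb c v) (lincomb d v)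
  isometry-lincomb {L} symL w v isometry c d = begin
    B L (lincomb c w) (lincomb d w)                                 ≡⟨ B-lincombˡ c w (lincomb d w) ⟩
    sumFin (λ i → c i * B L (w i) (lincomb d w))                    ≡⟨ sum-cong (λ i → cong (c i *_) (B-lincombʳ (w i) d w)) ⟩
    sumFin (λ i → c i * sumFin (λ j → d j * B L (w i) (w j)))       ≡⟨ sum-cong (λ i → cong (c i *_) (sum-cong (λ j → cong (d j *_) (entry i j)))) ⟩
    sumFin (λ i → c i * sumFin (λ j → d j * dot (v j) (v i)))       ≡⟨ sum-cong (λ i → cong (c i *_) (dot-lincombˡ d v (v i))) ⟨
    sumFin (λ i → c i * dot (lincomb d v) (v i))                    ≡⟨ sum-cong (λ i → cong (c i *_) (dot-comm (lincomb d v) (v i))) ⟩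
    sumFin (λ i → c i * dot (v i) (lincomb d v))                    ≡⟨ dot-lincombˡ c v (lincomb d v) ⟨
    dot (lincomb c v) (lincomb d v)                                 ∎
    where
    open ≡-Reasoning
    open Bilinear L
    open Sym symL
    entry : ∀ i j → B L (w i) (w j) ≡ dot (v j) (v i)
    entry i j = trans (isometry i j) (dot-comm (v i) (v j))

  B-I : ∀ {n} (x y : Vecℤ n) → B (I n) x y ≡ dot x y
  B-I {n} x y = trans (Bilinear.B-dot (I n) x y) (sum-cong (λ i → cong (x i *_) (dot-e i y)))

  B-fromBasis : ∀ {n k} (v : Fin k → Vecℤ n) (x y : Vecℤ k) →
                B (fromBasis v) x y ≡ dot (lincomb x v) (lincomb y v)
  B-fromBasis v x y = begin
    sumFin (λ i → sumFin (λ j → x i * dot (v i) (v j) * y j))  ≡⟨ sum-cong (λ i → sum-cong (λ j → entry i j)) ⟩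
    sumFin (λ i → sumFin (λ j → x i * (y j * dot (v j) (v i)))) ≡⟨ sum-cong (λ i → sum-*ˡ (x i) (λ j → y j * dot (v j) (v i))) ⟩
    sumFin (λ i → x i * sumFin (λ j → y j * dot (v j) (v i)))  ≡⟨ sum-cong (λ i → cong (x i *_) (dot-lincombˡ y v (v i))) ⟨
    sumFin (λ i → x i * dot (lincomb y v) (v i))               ≡⟨ sum-cong (λ i → cong (x i *_) (dot-comm (lincomb y v) (v i))) ⟩
    sumFin (λ i → x i * dot (v i) (lincomb y v))               ≡⟨ dot-lincombˡ x v (lincomb y v) ⟨
    dot (lincomb x v) (lincomb y v)                            ∎
    where
    open ≡-Reasoning
    ring : ∀ a b c → a * b * c ≡ a * (c * b)
    ring = solve-∀
    entry : ∀ i j → x i * dot (v i) (v j) * y j ≡ x i * (y j * dot (v j) (v i))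
    entry i j = trans (ring (x i) (dot (v i) (v j)) (y j)) (cong (λ t → x i * (y j * t)) (dot-comm (v i) (v j)))

  -- Nonnegativity is carried along because anisotropy alone does not pass to orthogonal sums.
  record Definite (M : QForm) : Set where
    field
      nonneg      : ∀ x → 0ℤ ℤ.≤ Q M x
      anisotropic : Anisotropic M
  open Definite

  dot-nonneg : ∀ {n} (x : Vecℤ n) → 0ℤ ℤ.≤ dot x x
  dot-nonneg x = sum-nonneg (λ i → square-nonneg (x i))

  dot≡0⇒≡0 : ∀ {n} (x : Vecℤ n) → dot x x ≡ 0ℤ → ∀ i → x i ≡ 0ℤ
  dot≡0⇒≡0 x x∙x≡0 i = [ (λ eq → eq) , (λ eq → eq) ] (ℤₚ.i*j≡0⇒i≡0∨j≡0 (x i) (ℤₚ.≤-antisym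
    (subst (x i * x i ℤ.≤_) x∙x≡0 (term≤sum (λ i → x i * x i) (λ i → square-nonneg (x i)) i)) (square-nonneg (x i))))

  definite-I : ∀ n → Definite (I n)
  definite-I n .nonneg x           = subst (0ℤ ℤ.≤_) (sym (B-I x x)) (dot-nonneg x)
  definite-I n .anisotropic x Qx≡0 = dot≡0⇒≡0 x (trans (sym (B-I x x)) Qx≡0)

  definite-fromBasis : ∀ {n k} (v : Fin k → Vecℤ n) → Independent v → Definite (fromBasis v)
  definite-fromBasis v indep .nonneg x =
    subst (0ℤ ℤ.≤_) (sym (B-fromBasis v x x)) (dot-nonneg (lincomb x v))
  definite-fromBasis v indep .anisotropic x Qx≡0 =
    indep x (dot≡0⇒≡0 (lincomb x v) (trans (sym (B-fromBasis v x x)) Qx≡0))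

  definite-zeroL : Definite zeroL
  definite-zeroL .nonneg x         = ℤₚ.≤-refl
  definite-zeroL .anisotropic x _ ()

  module _ (M N : QForm) where

    private
      m n : ℕ
      m = rank M
      n = rank N

    gram-⊥-ˡˡ : ∀ i j → gram (M ⊥ N) (i ↑ˡ n) (j ↑ˡ n) ≡ gram M i j
    gram-⊥-ˡˡ i j rewrite Finₚ.splitAt-↑ˡ m i n | Finₚ.splitAt-↑ˡ m j n = refl

    gram-⊥-ˡʳ : ∀ i j → gram (M ⊥ N) (i ↑ˡ n) (m ↑ʳ j) ≡ 0ℤ
    gram-⊥-ˡʳ i j rewrite Finₚ.splitAt-↑ˡ m i n | Finₚ.splitAt-↑ʳ m n j = refl

    gram-⊥-ʳˡ : ∀ i j → gram (M ⊥ N) (m ↑ʳ i) (j ↑ˡ n) ≡ 0ℤ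
    gram-⊥-ʳˡ i j rewrite Finₚ.splitAt-↑ʳ m n i | Finₚ.splitAt-↑ˡ m j n = refl

    gram-⊥-ʳʳ : ∀ i j → gram (M ⊥ N) (m ↑ʳ i) (m ↑ʳ j) ≡ gram N i j
    gram-⊥-ʳʳ i j rewrite Finₚ.splitAt-↑ʳ m n i | Finₚ.splitAt-↑ʳ m n j = refl

    Q-⊥ : ∀ x → Q (M ⊥ N) x ≡ Q M (λ i → x (i ↑ˡ n)) + Q N (λ j → x (m ↑ʳ j))
    Q-⊥ x = trans (sum-++ m (λ i → sumFin (λ j → x i * gram (M ⊥ N) i j * x j)))
                  (cong₂ _+_ (sum-cong rowˡ) (sum-cong rowʳ))
      where
      zero-entry : ∀ a {g} b → g ≡ 0ℤ → a * g * b ≡ 0ℤ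
      zero-entry a b refl = cong (_* b) (ℤₚ.*-zeroʳ a)
      rowˡ : ∀ i → sumFin (λ j → x (i ↑ˡ n) * gram (M ⊥ N) (i ↑ˡ n) j * x j)
                 ≡ sumFin (λ j → x (i ↑ˡ n) * gram M i j * x (j ↑ˡ n))
      rowˡ i = trans (sum-++ m (λ j → x (i ↑ˡ n) * gram (M ⊥ N) (i ↑ˡ n) j * x j))
        (trans (cong₂ _+_ (sum-cong (λ j → cong (λ g → x (i ↑ˡ n) * g * x (j ↑ˡ n)) (gram-⊥-ˡˡ i j)))
                          (sum-zero (λ j → zero-entry (x (i ↑ˡ n)) (x (m ↑ʳ j)) (gram-⊥-ˡʳ i j))))
               (ℤₚ.+-identityʳ _))
      rowʳ : ∀ i → sumFin (λ j → x (m ↑ʳ i) * gram (M ⊥ N) (m ↑ʳ i) j * x j)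
                 ≡ sumFin (λ j → x (m ↑ʳ i) * gram N i j * x (m ↑ʳ j))
      rowʳ i = trans (sum-++ m (λ j → x (m ↑ʳ i) * gram (M ⊥ N) (m ↑ʳ i) j * x j))
        (trans (cong₂ _+_ (sum-zero (λ j → zero-entry (x (m ↑ʳ i)) (x (j ↑ˡ n)) (gram-⊥-ʳˡ i j)))
                          (sum-cong (λ j → cong (λ g → x (m ↑ʳ i) * g * x (m ↑ʳ j)) (gram-⊥-ʳʳ i j))))
               (ℤₚ.+-identityˡ _))

    definite-⊥ : Definite M → Definite N → Definite (M ⊥ N)
    definite-⊥ dM dN .nonneg x = subst (0ℤ ℤ.≤_) (sym (Q-⊥ x))
      (ℤₚ.+-mono-≤ (nonneg dM (λ i → x (i ↑ˡ n))) (nonneg dN (λ j → x (m ↑ʳ j))))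
    definite-⊥ dM dN .anisotropic x Qx≡0 i =
      subst (λ i → x i ≡ 0ℤ) (Finₚ.join-splitAt m n i) (vanish (splitAt m i))
      where
      summands-zero : ∀ {a b} → 0ℤ ℤ.≤ a → 0ℤ ℤ.≤ b → a + b ≡ 0ℤ → a ≡ 0ℤ × b ≡ 0ℤ
      summands-zero {+ zero}  {+ zero}  _ _ _ = refl , refl
      summands-zero {+ zero}  {+ suc _} _ _ ()
      summands-zero {+ suc _} {+ _}     _ _ ()
      xˡ : Vecℤ m
      xˡ i = x (i ↑ˡ n)
      xʳ : Vecℤ n
      xʳ j = x (m ↑ʳ j)
      Q≡0 : Q M xˡ ≡ 0ℤ × Q N xʳ ≡ 0ℤ
      Q≡0 = summands-zero (nonneg dM xˡ) (nonneg dN xʳ) (trans (sym (Q-⊥ x)) Qx≡0)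
      vanish : ∀ s → x (join m n s) ≡ 0ℤ
      vanish (inj₁ i) = anisotropic dM xˡ (proj₁ Q≡0) i
      vanish (inj₂ j) = anisotropic dN xʳ (proj₂ Q≡0) j

  definite-copies : ∀ k {M} → Definite M → Definite (copies k M)
  definite-copies zero    dM = definite-zeroL
  definite-copies (suc k) dM = definite-⊥ _ _ dM (definite-copies k dM)

  rank-copies : ∀ k M → rank (copies k M) ≡ k ℕ.* rank M
  rank-copies zero    M = refl
  rank-copies (suc k) M = cong (rank M ℕ.+_) (rank-copies k M)

  -- Coordinate zero reads `a - c zero = 0`, and the other coordinates form the same system with
  -- `c zero` in place of `a`. The value `a = 0` serves `A`, and `a = 2 c₀` serves `D`.
  telescope : ∀ m a (c : Vecℤ m) →
              (∀ j → a * e zero j + lincomb c (λ i j → e (suc i) j - e (inject₁ i) j) j ≡ 0ℤ) →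
              a ≡ 0ℤ × (∀ i → c i ≡ 0ℤ)
  telescope zero    a c eq = trans (ring a) (eq zero) , λ ()
    where
    ring : ∀ a → a ≡ a * 1ℤ + 0ℤ
    ring = solve-∀
  telescope (suc m) a c eq = a≡0 , λ { zero → c₀≡0 ; (suc i) → proj₂ IH i }
    where
    open ≡-Reasoning
    c₀ : ℤ
    c₀ = c zero
    IH : c₀ ≡ 0ℤ × (∀ i → c (suc i) ≡ 0ℤ)
    IH = telescope m c₀ (c ∘ suc) λ j → trans (ring a c₀ (e zero j) _) (eq (suc j))
      where
      ring : ∀ a c x s → c * x + s ≡ a * 0ℤ + (c * (x - 0ℤ) + s)
      ring = solve-∀
    c₀≡0 : c₀ ≡ 0ℤ
    c₀≡0 = proj₁ IH
    a≡0 : a ≡ 0ℤ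
    a≡0 = begin
      a                                                      ≡⟨ ring a ⟩
      a * 1ℤ + (0ℤ * (0ℤ - 1ℤ) + 0ℤ)
        ≡⟨ cong₂ (λ s t → a * 1ℤ + (s * (0ℤ - 1ℤ) + t)) c₀≡0
                 (sum-zero (λ i → ℤₚ.*-zeroʳ (c (suc i)))) ⟨
      a * 1ℤ + (c₀ * (0ℤ - 1ℤ) + sumFin (λ i → c (suc i) * 0ℤ))  ≡⟨ eq zero ⟩
      0ℤ ∎
      where
      ring : ∀ a → a ≡ a * 1ℤ + (0ℤ * (0ℤ - 1ℤ) + 0ℤ)
      ring = solve-∀

  definite-Aminus1 : ∀ n → Definite (Aminus1 n)
  definite-Aminus1 zero    = definite-zeroL
  definite-Aminus1 (suc m) = definite-fromBasis roots λ c eq →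
    proj₂ (telescope m 0ℤ c (λ j → trans (ring (e zero j) (lincomb c roots j)) (eq j)))
    where
    roots : Fin m → Vecℤ (suc m)
    roots i j = e (suc i) j - e (inject₁ i) j
    ring : ∀ x y → 0ℤ * x + y ≡ y
    ring = solve-∀

  definite-D : ∀ n → Definite (D n)
  definite-D zero    = definite-zeroL
  definite-D (suc m) = definite-fromBasis (Dbasis m) λ c eq →
    let a≡0 , c≡0 = telescope m (c zero * + 2) (c ∘ suc) (λ j →
          trans (cong (_+ lincomb (c ∘ suc) (Dbasis m ∘ suc) j) (ℤₚ.*-assoc (c zero) (+ 2) (e zero j))) (eq j))
    in λ { zero → ℤₚ.*-cancelʳ-≡ (c zero) 0ℤ (+ 2) a≡0 ; (suc i) → c≡0 i }

  -- A basis of { x : p ∣ Σ x i }.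
  congruenceBasis : ∀ m → ℕ → Fin (suc m) → Vecℤ (suc m)
  congruenceBasis m p zero    j = + p * e zero j
  congruenceBasis m p (suc k) j = e (suc k) j - e zero j

  module _ (m p : ℕ) where

    private
      v : Fin (suc m) → Vecℤ (suc m)
      v = congruenceBasis m p

    congruence-coordinate-suc : ∀ c j → lincomb c v (suc j) ≡ c (suc j)
    congruence-coordinate-suc c j = begin
      c zero * (+ p * 0ℤ) + sumFin (λ k → c (suc k) * (e k j - 0ℤ))
        ≡⟨ cong₂ _+_ (ring₁ (c zero) (+ p))
             (sum-cong (λ k → trans (ring₂ (c (suc k)) (e k j)) (cong (_* c (suc k)) (e-sym k j)))) ⟩
      0ℤ + sumFin (λ k → e j k * c (suc k))
        ≡⟨ ℤₚ.+-identityˡ _ ⟩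
      sumFin (λ k → e j k * c (suc k))
        ≡⟨ sum-eˡ j (c ∘ suc) ⟩
      c (suc j) ∎
      where
      open ≡-Reasoning
      ring₁ : ∀ c p → c * (p * 0ℤ) ≡ 0ℤ
      ring₁ = solve-∀
      ring₂ : ∀ c x → c * (x - 0ℤ) ≡ x * c
      ring₂ = solve-∀

    congruence-coordinate-zero : ∀ c → (∀ j → c (suc j) ≡ 0ℤ) → lincomb c v zero ≡ c zero * + p
    congruence-coordinate-zero c c≡0 = begin
      c zero * (+ p * 1ℤ) + sumFin (λ k → c (suc k) * (0ℤ - 1ℤ))
        ≡⟨ cong₂ _+_ (cong (c zero *_) (ℤₚ.*-identityʳ (+ p))) (sum-zero (λ k → cong (_* (0ℤ - 1ℤ)) (c≡0 k))) ⟩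
      c zero * + p + 0ℤ
        ≡⟨ ℤₚ.+-identityʳ _ ⟩
      c zero * + p ∎
      where open ≡-Reasoning

    congruence-independent : .{{_ : ℕ.NonZero p}} → Independent v
    congruence-independent c eq = λ { zero → c₀≡0 ; (suc j) → c≡0 j }
      where
      instance
        P≢0 : ℤ.NonZero (+ p)
        P≢0 = ℤ.≢-nonZero (λ eq → ℕ.≢-nonZero⁻¹ p (ℤₚ.+-injective eq))
      c≡0 : ∀ j → c (suc j) ≡ 0ℤ
      c≡0 j = trans (sym (congruence-coordinate-suc c j)) (eq (suc j))
      c₀≡0 : c zero ≡ 0ℤ
      c₀≡0 = ℤₚ.*-cancelʳ-≡ (c zero) 0ℤ (+ p) (trans (sym (congruence-coordinate-zero c c≡0)) (eq zero))

    -- If `e zero` lay in the span, all later coefficients would vanish and `p` would divide 1.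
    congruence-proper : p ≢ 1 → ¬ Spans v
    congruence-proper p≢1 spans = p≢1 (ℕ∣.∣1⇒≡1 (∣⇒∣ᵤ (divides (c zero) (begin
      1ℤ                  ≡⟨ eq zero ⟨
      lincomb c v zero    ≡⟨ congruence-coordinate-zero c (λ j → trans (sym (congruence-coordinate-suc c j)) (eq (suc j))) ⟩
      c zero * + p        ∎))))
      where
      open ≡-Reasoning
      c : Vecℤ (suc m)
      c = proj₁ (spans (e zero))
      eq : ∀ j → lincomb c v j ≡ e zero j
      eq = proj₂ (spans (e zero))

  -- Frames, unit vectors and root systems inside an isolation.

  module Isolation {m : ℕ} {L : QForm} (iso : IsIsolation (I (suc m)) L) where

    isLattice : IsLattice L
    isLattice = proj₁ iso

    ¬I : ¬ Represents L (I (suc m))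
    ¬I = proj₂ (proj₂ iso)

    open Bilinear L
    open Sym (proj₁ isLattice)
    open Frames isLattice

    private
      _∙_ : V → V → ℤ
      _∙_ = B L
      infix 8 _∙_

    sublattice-vectors : ∀ {k} (v : Fin k → Vecℤ (suc m)) → Independent v → ¬ Spans v →
                         Σ (Fin k → V) λ w → ∀ i j → w i ∙ w j ≡ dot (v i) (v j)
    sublattice-vectors v indep proper =
      proj₁ vectors , λ i j → trans (proj₂ vectors i j) (B-I (v i) (v j))
      where
      vectors : Σ (Fin _ → V) λ w → ∀ i j → w i ∙ w j ≡ B (I (suc m)) (v i) (v j)
      vectors = represents⇒vectors (proj₁ isLattice)
        (λ i j → Bilinear.Sym.B-sym (I (suc m)) e-sym (v i) (v j)) (proj₁ (proj₂ iso) _ v indep proper)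

    -- These come from the proper sublattice of vectors whose first coordinate is zero.
    orthonormal : Σ (Fin m → V) λ c → ∀ i j → c i ∙ c j ≡ e i j
    orthonormal = proj₁ vectors , λ i j → trans (proj₂ vectors i j) (trans (dot-e (suc i) (e (suc j))) (e-sym j i))
      where
      v : Fin m → Vecℤ (suc m)
      v i = e (suc i)
      coordinate : ∀ c j → lincomb c v (suc j) ≡ c j
      coordinate c j = trans (sum-cong (λ i → trans (ℤₚ.*-comm (c i) (e i j)) (cong (_* c i) (e-sym i j)))) (sum-eˡ j c)
      vectors : Σ (Fin m → V) λ w → ∀ i j → w i ∙ w j ≡ dot (v i) (v j)
      vectors = sublattice-vectors v
        (λ c eq i → trans (sym (coordinate c i)) (eq (suc i)))
        (λ spans → let c , eq = spans (e zero) in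
          contradiction (trans (sym (eq zero)) (sum-zero (λ i → ℤₚ.*-zeroʳ (c i)))) λ ())

    -- The vectors `w` represent `p e₀` and `eᵢ - e₀`. With `e₀` as base point, `r i` represents
    -- `eᵢ - e₀` and `u i = w zero + p r i` represents `p eᵢ`.
    frame : ∀ p .{{_ : ℕ.NonZero p}} → p ≢ 1 → Frame L (suc m) p
    frame p p≢1 = record { u = u ; r = r ; shift = λ i j k → ring (+ p) (w zero k) (r i k) (r j k) ; orthogonal = orthogonal }
      where
      v : Fin (suc m) → Vecℤ (suc m)
      v = congruenceBasis m p
      vectors : Σ (Fin (suc m) → V) λ w → ∀ i j → w i ∙ w j ≡ dot (v i) (v j)
      vectors = sublattice-vectors v (congruence-independent m p) (congruence-proper m p p≢1)
      w : Fin (suc m) → V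
      w = proj₁ vectors
      r u : Fin (suc m) → V
      r zero    k = 0ℤ
      r (suc i) k = w (suc i) k
      u i k = w zero k + + p * r i k
      ring : ∀ p w a b → p * (a - b) ≡ (w + p * a) - (w + p * b)
      ring = solve-∀
      -- The coordinates of `p eᵢ` with respect to the basis `v`, as `pe≡` confirms.
      c : Fin (suc m) → Vecℤ (suc m)
      c zero    = e zero
      c (suc i) l = 1ℤ * e zero l + + p * e (suc i) l
      u≡ : ∀ i k → u i k ≡ lincomb (c i) w k
      u≡ zero    k = begin
        w zero k + + p * 0ℤ              ≡⟨ ring₀ (w zero k) (+ p) ⟩
        w zero k                         ≡⟨ sum-eˡ zero (λ l → w l k) ⟨
        dot (e zero) (λ l → w l k)       ∎
        where
        open ≡-Reasoning
        ring₀ : ∀ a p → a + p * 0ℤ ≡ a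
        ring₀ = solve-∀
      u≡ (suc i) k = begin
        w zero k + + p * w (suc i) k
          ≡⟨ cong (_+ + p * w (suc i) k) (ℤₚ.*-identityˡ (w zero k)) ⟨
        1ℤ * w zero k + + p * w (suc i) k
          ≡⟨ cong₂ (λ s t → 1ℤ * s + + p * t) (dot-e zero (λ l → w l k)) (dot-e (suc i) (λ l → w l k)) ⟨
        1ℤ * dot (e zero) (λ l → w l k) + + p * dot (e (suc i)) (λ l → w l k)
          ≡⟨ dot-combˡ 1ℤ (e zero) (+ p) (e (suc i)) (λ l → w l k) ⟨
        lincomb (c (suc i)) w k ∎
        where open ≡-Reasoning
      pe≡ : ∀ i k → lincomb (c i) v k ≡ + p * e i k
      pe≡ zero    k = sum-eˡ zero (λ l → v l k)
      pe≡ (suc i) k = begin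
        lincomb (c (suc i)) v k
          ≡⟨ dot-combˡ 1ℤ (e zero) (+ p) (e (suc i)) (λ l → v l k) ⟩
        1ℤ * dot (e zero) (λ l → v l k) + + p * dot (e (suc i)) (λ l → v l k)
          ≡⟨ cong₂ (λ s t → 1ℤ * s + + p * t) (dot-e zero (λ l → v l k)) (dot-e (suc i) (λ l → v l k)) ⟩
        1ℤ * (+ p * e zero k) + + p * (e (suc i) k - e zero k)
          ≡⟨ ring₁ (+ p) (e zero k) (e (suc i) k) ⟩
        + p * e (suc i) k ∎
        where
        open ≡-Reasoning
        ring₁ : ∀ p a b → 1ℤ * (p * a) + p * (b - a) ≡ p * b
        ring₁ = solve-∀
      orthogonal : ∀ i j → u i ∙ u j ≡ + p * + p * e i j
      orthogonal i j = begin
        u i ∙ u j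
          ≡⟨ trans (B-congˡ (u≡ i) (u j)) (B-congʳ (lincomb (c i) w) (u≡ j)) ⟩
        lincomb (c i) w ∙ lincomb (c j) w
          ≡⟨ isometry-lincomb (proj₁ isLattice) w v (proj₂ vectors) (c i) (c j) ⟩
        dot (lincomb (c i) v) (lincomb (c j) v)
          ≡⟨ sum-cong (λ k → cong₂ _*_ (pe≡ i k) (pe≡ j k)) ⟩
        sumFin (λ k → + p * e i k * (+ p * e j k))
          ≡⟨ sum-cong (λ k → ring₂ (+ p) (e i k) (e j k)) ⟩
        sumFin (λ k → + p * + p * (e i k * e j k))
          ≡⟨ sum-*ˡ (+ p * + p) (λ k → e i k * e j k) ⟩
        + p * + p * dot (e i) (e j)
          ≡⟨ cong (+ p * + p *_) (trans (dot-e i (e j)) (e-sym j i)) ⟩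
        + p * + p * e i j ∎
        where
        open ≡-Reasoning
        ring₂ : ∀ p a b → p * a * (p * b) ≡ p * p * (a * b)
        ring₂ = solve-∀

    open Frame

    roots : ∀ {p} → Frame L (suc m) p → Fin m → V
    roots F i k = r F (suc i) k - r F (inject₁ i) k

    roots-gram : ∀ {p} .{{_ : ℕ.NonZero p}} (F : Frame L (suc m) p) →
                 ∀ i j → roots F i ∙ roots F j ≡ gram (Aminus1 (suc m)) i j
    roots-gram F i j = divided-dot F (λ l → e (suc i) l - e (inject₁ i) l) (λ l → e (suc j) l - e (inject₁ j) l)
      (root-lincomb F (suc i) (inject₁ i)) (root-lincomb F (suc j) (inject₁ j))

    -- At level 2 the frame vector `u zero` stands for `2 e₀`, so these match `Dbasis` entry by
    -- entry.
    D-vectors : Frame L (suc m) 2 → Fin (suc m) → V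
    D-vectors F zero    = u F zero
    D-vectors F (suc i) = roots F i

    D-gram : (F : Frame L (suc m) 2) → ∀ i j → D-vectors F i ∙ D-vectors F j ≡ gram (D (suc m)) i j
    D-gram F i j = divided-dot F (Dbasis m i) (Dbasis m j) (expand i) (expand j)
      where
      expand : ∀ i k → + 2 * D-vectors F i k ≡ lincomb (Dbasis m i) (u F) k
      expand zero    k = sym (begin
        sumFin (λ l → + 2 * e zero l * u F l k)      ≡⟨ sum-cong (λ l → ℤₚ.*-assoc (+ 2) (e zero l) (u F l k)) ⟩
        sumFin (λ l → + 2 * (e zero l * u F l k))    ≡⟨ sum-*ˡ (+ 2) (λ l → e zero l * u F l k) ⟩
        + 2 * sumFin (λ l → e zero l * u F l k)      ≡⟨ cong (+ 2 *_) (sum-eˡ zero (λ l → u F l k)) ⟩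
        + 2 * u F zero k                             ∎)
        where open ≡-Reasoning
      expand (suc i) = root-lincomb F (suc i) (inject₁ i)

    System : QForm → Set
    System M = Σ (Fin (rank M) → V) λ w → ∀ i j → w i ∙ w j ≡ gram M i j

    -- The second component allows orthogonal sums to be iterated.
    ⊥-system : ∀ {M N} (S₁ : System M) (S₂ : System N) → (∀ i j → proj₁ S₁ i ∙ proj₁ S₂ j ≡ 0ℤ) →
               Σ (System (M ⊥ N)) λ S → ∀ z → (∀ i → z ∙ proj₁ S₁ i ≡ 0ℤ) → (∀ j → z ∙ proj₁ S₂ j ≡ 0ℤ) →
                 ∀ i → z ∙ proj₁ S i ≡ 0ℤ
    ⊥-system {M} {N} (w₁ , gram₁) (w₂ , gram₂) cross = (w , gram≡) , z∙w
      where
      w : Fin (rank M ℕ.+ rank N) → V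
      w i = [ w₁ , w₂ ] (splitAt (rank M) i)
      gram≡ : ∀ i j → w i ∙ w j ≡ gram (M ⊥ N) i j
      gram≡ i j with splitAt (rank M) i | splitAt (rank M) j
      ... | inj₁ a | inj₁ b = gram₁ a b
      ... | inj₂ a | inj₂ b = gram₂ a b
      ... | inj₁ a | inj₂ b = cross a b
      ... | inj₂ a | inj₁ b = trans (B-sym (w₂ a) (w₁ b)) (cross b a)
      z∙w : ∀ z → (∀ i → z ∙ w₁ i ≡ 0ℤ) → (∀ j → z ∙ w₂ j ≡ 0ℤ) → ∀ i → z ∙ w i ≡ 0ℤ
      z∙w z z∙w₁ z∙w₂ i with splitAt (rank M) i
      ... | inj₁ a = z∙w₁ a
      ... | inj₂ b = z∙w₂ b

    Small : ℕ → Set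
    Small p = Prime p × 2 ℕ.* p ℕ.* p ℕ.< suc m

    prime-coprime : ∀ {p q} → Prime p → Prime q → p ≢ q → Coprime p q
    prime-coprime {p} {q} pp pq p≢q {d} (d∣p , d∣q)
      with prime⇒irreducible pp d∣p | prime⇒irreducible pq d∣q
    ... | inj₁ d≡1 | _        = d≡1
    ... | inj₂ _   | inj₁ d≡1 = d≡1
    ... | inj₂ d≡p | inj₂ d≡q = contradiction (trans (sym d≡p) d≡q) p≢q

    small-nonZero : ∀ {p} → Small p → ℕ.NonZero p
    small-nonZero (pp , _) = prime⇒nonZero pp

    small-frame : ∀ {p} → Small p → Frame L (suc m) p
    small-frame {p} (pp , _) = frame p {{prime⇒nonZero pp}} (λ { refl → ¬prime[1] pp })

    module _ {p q} (sp : Small p) (sq : Small q) (p≢q : p ≢ q) where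

      private
        instance
          p≢0 : ℕ.NonZero p
          p≢0 = small-nonZero sp
          q≢0 : ℕ.NonZero q
          q≢0 = small-nonZero sq
        coprime : Coprime p q
        coprime = prime-coprime (proj₁ sp) (proj₁ sq) p≢q

      small-frame⊥roots : ∀ i j → u (small-frame sp) i ∙ roots (small-frame sq) j ≡ 0ℤ
      small-frame⊥roots i j = frame⊥roots ¬I (small-frame sp) (small-frame sq) coprime (proj₂ sp) (proj₂ sq)
        i (suc j) (inject₁ j)

      small-roots⊥roots : ∀ i j → roots (small-frame sp) i ∙ roots (small-frame sq) j ≡ 0ℤ
      small-roots⊥roots i j = roots⊥roots ¬I (small-frame sp) (small-frame sq) coprime (proj₂ sp) (proj₂ sq)
        (suc i) (inject₁ i) (suc j) (inject₁ j)

    small-roots : ∀ {p} → Small p → System (Aminus1 (suc m))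
    small-roots sp = roots (small-frame sp) , roots-gram {{small-nonZero sp}} (small-frame sp)

    -- The orthogonality clause allows an arbitrary `z`, so that the next prime, then `D`, then the
    -- unit vectors can be put in front.
    copies-system : ∀ {ps} → AllPairs _≢_ ps → All Small ps →
      Σ (System (copies (length ps) (Aminus1 (suc m)))) λ S → ∀ z →
        (∀ {q} (sq : Small q) → q ∈ ps → ∀ j → z ∙ roots (small-frame sq) j ≡ 0ℤ) → ∀ i → z ∙ proj₁ S i ≡ 0ℤ
    copies-system []             []         = ((λ ()) , λ ()) , λ z _ ()
    copies-system (p≢ps ∷ distinct) (sp ∷ sps) =
      let S , ⊥S   = copies-system distinct sps
          S′ , ⊥S′ = ⊥-system (small-roots sp) S λ i → ⊥S (proj₁ (small-roots sp) i) λ sq q∈ps j →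
                       small-roots⊥roots sp sq (All.lookup p≢ps q∈ps) i j
      in S′ , λ z z⊥ → ⊥S′ z (z⊥ sp (here refl)) (⊥S z (λ sq q∈ps → z⊥ sq (there q∈ps)))

    unit⊥roots : ∀ {q} (sq : Small q) i j → proj₁ orthonormal i ∙ roots (small-frame sq) j ≡ 0ℤ
    unit⊥roots sq i j = constant⇒∙root≡0 ¬I {{small-nonZero sq}} (small-frame sq) (proj₁ orthonormal i)
      (λ a b → trans (c∙u≡0 a) (sym (c∙u≡0 b))) (suc j) (inject₁ j)
      where
      c∙u≡0 : ∀ a → proj₁ orthonormal i ∙ u (small-frame sq) a ≡ 0ℤ
      c∙u≡0 = unit⊥frame ¬I {{small-nonZero sq}} (small-frame sq) (proj₂ sq) (proj₁ orthonormal i)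
        (trans (proj₂ orthonormal i i) (e-diag i))

    -- The prime 2 is kept apart because its frame supplies `D`. Besides its roots this needs the
    -- vector `u zero`, which `small-frame⊥roots` makes orthogonal to the roots of the other primes.
    represents-sum : ∀ {ps} → Small 2 → AllPairs _≢_ (2 ∷ ps) → All Small ps →
                     Represents L (I m ⊥ D (suc m) ⊥ copies (length ps) (Aminus1 (suc m)))
    represents-sum {ps} s2 (2≢ps ∷ distinct) sps =
      represents (I m ⊥ D (suc m) ⊥ copies (length ps) (Aminus1 (suc m))) (proj₁ S) (proj₂ S)
      where
      F : Frame L (suc m) 2
      F = small-frame s2
      A = copies-system distinct sps
      DA = ⊥-system (D-vectors F , D-gram F) (proj₁ A) λ i → proj₂ A (D-vectors F i) λ sq q∈ps → D⊥roots sq (All.lookup 2≢ps q∈ps) i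
        where
        D⊥roots : ∀ {q} (sq : Small q) → 2 ≢ q → ∀ i j → D-vectors F i ∙ roots (small-frame sq) j ≡ 0ℤ
        D⊥roots sq 2≢q zero    = small-frame⊥roots s2 sq 2≢q zero
        D⊥roots sq 2≢q (suc i) = small-roots⊥roots s2 sq 2≢q i
      S : System (I m ⊥ D (suc m) ⊥ copies (length ps) (Aminus1 (suc m)))
      S = proj₁ (⊥-system orthonormal (proj₁ DA) λ i → proj₂ DA (proj₁ orthonormal i)
            (unit⊥D i) (proj₂ A (proj₁ orthonormal i) λ sq _ → unit⊥roots sq i))
        where
        unit⊥D : ∀ i j → proj₁ orthonormal i ∙ D-vectors F j ≡ 0ℤ
        unit⊥D i zero    = unit⊥frame ¬I F (proj₂ s2) (proj₁ orthonormal i) (trans (proj₂ orthonormal i i) (e-diag i)) zero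
        unit⊥D i (suc j) = unit⊥roots s2 i j

    -- This serves the case without small primes, where the claimed bound is just `n`: the vectors
    -- with even coordinate sum form a proper sublattice of full rank.
    rank≥n : suc m ℕ.≤ rank L
    rank≥n = represents⇒rank≤ {L} {fromBasis v}
      (definite-fromBasis v (congruence-independent m 2) .anisotropic)
      (represents (fromBasis v) (proj₁ vectors) (proj₂ vectors))
      where
      open Definite
      v : Fin (suc m) → Vecℤ (suc m)
      v = congruenceBasis m 2
      vectors : Σ (Fin (suc m) → V) λ w → ∀ i j → w i ∙ w j ≡ dot (v i) (v j)
      vectors = sublattice-vectors v (congruence-independent m 2) (congruence-proper m 2 λ ())

-- A lower bound for the number of primes, through common multiples and beta integrals.

module Chebyshev where

  open import Data.Nat
  open import Data.Nat.Properties
  open import Data.Nat.Divisibility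
  open import Data.Nat.Induction using (<-rec)
  open import Data.Nat.ListAction using (product)
  open import Data.Nat.Primality using (Prime; prime⇒nonZero; prime⇒nonTrivial; prime⇒irreducible)
  open import Data.Nat.Primality.Factorisation using (factorise)
  open import Data.Nat.Coprimality using (Coprime; coprime-divisor)
  import Data.Nat.DivMod as DivMod
  import Data.Integer as ℤ
  import Data.Integer.Properties as ℤₚ
  import Data.Integer.Tactic.RingSolver as ℤRing
  open import Data.List using (List; []; _∷_; length; map)
  open import Data.List.Relation.Unary.All using (All; []; _∷_)
  open import Data.List.Relation.Unary.Any using (here; there)
  open import Data.List.Membership.Propositional using (_∈_)
  open import Data.Product using (∃; _×_; _,_)
  open import Data.Sum using (inj₁; inj₂)
  open import Relation.Nullary using (¬_; yes; no; contradiction)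
  open import Relation.Binary.PropositionalEquality

  prime∤⇒coprime : ∀ {p j} → Prime p → ¬ p ∣ j → Coprime j p
  prime∤⇒coprime pp p∤j (d∣j , d∣p) with prime⇒irreducible pp d∣p
  ... | inj₁ d≡1  = d≡1
  ... | inj₂ refl = contradiction d∣j p∤j

  coprime-power-divisor : ∀ {p j} → Coprime j p → ∀ a {x} → j ∣ p ^ a * x → j ∣ x
  coprime-power-divisor coprime zero    j∣x = subst (_ ∣_) (*-identityˡ _) j∣x
  coprime-power-divisor {p} {j} coprime (suc a) {x} j∣px =
    coprime-power-divisor coprime a (coprime-divisor coprime (subst (j ∣_) (*-assoc p (p ^ a) x) j∣px))

  maximal-power : ∀ {p} → Prime p → ∀ i → NonZero i → ∃ λ a → ∃ λ j → i ≡ p ^ a * j × ¬ p ∣ j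
  maximal-power {p} pp = <-rec _ step
    where
    step : ∀ i → (∀ {j} → j < i → NonZero j → ∃ λ a → ∃ λ k → j ≡ p ^ a * k × ¬ p ∣ k) →
           NonZero i → ∃ λ a → ∃ λ j → i ≡ p ^ a * j × ¬ p ∣ j
    step i rec i≢0 with p ∣? i
    ... | no  p∤i = 0 , i , sym (*-identityˡ i) , p∤i
    ... | yes p∣i =
      let a , j , eq , p∤j = rec (quotient-< p∣i {{prime⇒nonTrivial pp}} {{i≢0}}) (quotient≢0 p∣i {{i≢0}})
      in suc a , j , trans (m∣n⇒n≡m*quotient p∣i) (trans (cong (p *_) eq) (sym (*-assoc p (p ^ a) j))) , p∤j

  prime-divisor : ∀ i → 1 < i → ∃ λ p → Prime p × p ∣ i
  prime-divisor i 1<i with factorise i {{>-nonZero (<-trans z<s 1<i)}}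
  ... | record { factors = []     ; isFactorisation = i≡1 } = contradiction (sym i≡1) (<⇒≢ 1<i)
  ... | record { factors = p ∷ ps ; isFactorisation = eq ; factorsPrime = pp ∷ _ } =
    p , pp , divides (product ps) (trans eq (*-comm p (product ps)))

  -- Strong induction, removing one prime completely: for `i = pᵃ j` with `j` prime to `p`, write
  -- `M = x pᵃ`. By induction `j` divides `M`, and by coprimality it divides `x`.
  prime-powers∣⇒∣ : ∀ {M} i → NonZero i → (∀ {p} a → Prime p → p ^ a ∣ i → p ^ a ∣ M) → i ∣ M
  prime-powers∣⇒∣ {M} = <-rec _ step
    where
    step : ∀ i → (∀ {j} → j < i → NonZero j → (∀ {p} a → Prime p → p ^ a ∣ j → p ^ a ∣ M) → j ∣ M) →
           NonZero i → (∀ {p} a → Prime p → p ^ a ∣ i → p ^ a ∣ M) → i ∣ M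
    step i rec i≢0 powers with 1 <? i
    ... | no  i≤1 = subst (_∣ M) (≤-antisym (>-nonZero⁻¹ i {{i≢0}}) (≮⇒≥ i≤1)) (1∣ M)
    ... | yes 1<i with prime-divisor i 1<i
    ... | p , pp , p∣i with maximal-power pp i i≢0
    ... | zero , j , i≡j , p∤j = contradiction (subst (p ∣_) (trans i≡j (*-identityˡ j)) p∣i) p∤j
    ... | suc a , j , refl , p∤j with powers (suc a) pp (m∣m*n j)
    ... | pᵃ∣M@(divides x refl) = subst (p ^ suc a * j ∣_) (*-comm (p ^ suc a) x) (*-monoʳ-∣ (p ^ suc a)
            (coprime-power-divisor (prime∤⇒coprime pp p∤j) (suc a) (subst (j ∣_) (*-comm x (p ^ suc a))
              (rec j<i j≢0 λ b pq qᵇ∣j → powers b pq (∣n⇒∣m*n (p ^ suc a) qᵇ∣j)))))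
      where
      instance
        j≢0 : NonZero j
        j≢0 = m*n≢0⇒n≢0 (p ^ suc a) {{i≢0}}
        p≢0 : NonZero p
        p≢0 = prime⇒nonZero pp
      j<i : j < p ^ suc a * j
      j<i = subst (j <_) (*-comm j (p ^ suc a)) (m<m*n j (p ^ suc a)
              (<-≤-trans (nonTrivial⇒n>1 p {{prime⇒nonTrivial pp}}) (m≤m*n p (p ^ a) {{m^n≢0 p a}})))

  -- The exponent is sought downwards from `k`. For a prime `p`, starting at `k = N` misses no power
  -- up to `N`, by `n<p^n`.
  topPower : ℕ → ℕ → ℕ → ℕ
  topPower p N zero    = 1
  topPower p N (suc k) with p ^ suc k ≤? N
  ... | yes _ = p ^ suc k
  ... | no  _ = topPower p N k

  topPower≤ : ∀ p N k → 1 ≤ N → topPower p N k ≤ N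
  topPower≤ p N zero    1≤N = 1≤N
  topPower≤ p N (suc k) 1≤N with p ^ suc k ≤? N
  ... | yes pᵏ≤N = pᵏ≤N
  ... | no  _    = topPower≤ p N k 1≤N

  power∣topPower : ∀ p N k j → j ≤ k → p ^ j ≤ N → p ^ j ∣ topPower p N k
  power∣topPower p N zero    zero _ _ = ∣-refl
  power∣topPower p N (suc k) j j≤k pʲ≤N with p ^ suc k ≤? N
  ... | yes _ = subst (p ^ j ∣_) (trans (sym (^-distribˡ-+-* p j (suc k ∸ j))) (cong (p ^_) (m+[n∸m]≡n j≤k)))
                  (m∣m*n (p ^ (suc k ∸ j)))
  ... | no pᵏ≰N = power∣topPower p N k j (≤-pred (≤∧≢⇒< j≤k λ { refl → pᵏ≰N pʲ≤N })) pʲ≤N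

  n<p^n : ∀ {p} → 1 < p → ∀ n → n < p ^ n
  n<p^n 1<p zero    = z<s
  n<p^n {p} 1<p (suc n) = begin-strict
    suc n          ≤⟨ n<p^n 1<p n ⟩
    p ^ n          <⟨ m<m*n (p ^ n) p {{m^n≢0 p n {{>-nonZero (<-trans z<s 1<p)}}}} 1<p ⟩
    p ^ n * p      ≡⟨ *-comm (p ^ n) p ⟩
    p * p ^ n      ∎
    where open ≤-Reasoning

  -- If `ps` lists the primes up to `N` once each, this is lcm(1, ..., N); a larger prime only adds
  -- a factor 1.
  commonMultiple : ℕ → List ℕ → ℕ
  commonMultiple N ps = product (map (λ p → topPower p N N) ps)

  commonMultiple≤ : ∀ {N} → 1 ≤ N → ∀ ps → commonMultiple N ps ≤ N ^ length ps
  commonMultiple≤ 1≤N []       = ≤-refl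
  commonMultiple≤ {N} 1≤N (p ∷ ps) = *-mono-≤ (topPower≤ p N N 1≤N) (commonMultiple≤ {N} 1≤N ps)

  topPower∣commonMultiple : ∀ {N p ps} → p ∈ ps → topPower p N N ∣ commonMultiple N ps
  topPower∣commonMultiple {N} {ps = q ∷ ps} (here refl) = m∣m*n (commonMultiple N ps)
  topPower∣commonMultiple {N} {ps = q ∷ ps} (there p∈)  = ∣n⇒∣m*n (topPower q N N) (topPower∣commonMultiple {N} p∈)

  ∣commonMultiple : ∀ {N ps} → (∀ {p} → Prime p → p ≤ N → p ∈ ps) →
                    ∀ i → NonZero i → i ≤ N → i ∣ commonMultiple N ps
  ∣commonMultiple {N} {ps} complete i i≢0 i≤N = prime-powers∣⇒∣ i i≢0 powers
    where
    powers : ∀ {p} a → Prime p → p ^ a ∣ i → p ^ a ∣ commonMultiple N ps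
    powers zero    pp _    = 1∣ _
    powers {p} (suc a) pp pᵃ∣i = ∣-trans (power∣topPower p N N (suc a) (<⇒≤ (<-≤-trans (n<p^n 1<p (suc a)) pᵃ≤N)) pᵃ≤N)
                                   (topPower∣commonMultiple {N} (complete pp p≤N))
      where
      1<p : 1 < p
      1<p = nonTrivial⇒n>1 p {{prime⇒nonTrivial pp}}
      pᵃ≤N : p ^ suc a ≤ N
      pᵃ≤N = ≤-trans (∣⇒≤ {{i≢0}} pᵃ∣i) i≤N
      p≤N : p ≤ N
      p≤N = ≤-trans (m≤m*n p (p ^ a) {{m^n≢0 p a {{prime⇒nonZero pp}}}}) pᵃ≤N

  -- β a b = M ∫₀¹ xᵃ (1 - x)ᵇ dx = M a! b! / (a + b + 1)!
  module Beta (M N : ℕ) (divisible : ∀ i → NonZero i → i ≤ N → i ∣ M) where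

    open ℤ using (ℤ; +_)

    β : ℕ → ℕ → ℤ
    β a zero    = + (M / suc a)
    -- One factor `1 - x` is expanded. Every value is thus an integer combination of quotients
    -- `M / i`, which are exact for `i ≤ N`.
    β a (suc b) = β a b ℤ.- β (suc a) b

    -- These are the ratios of consecutive values of `a! b! / (a + b + 1)!`. The bound by `N` keeps
    -- all divisions in the induction on `b` exact.
    β-sucˡ : ∀ a b → 2 + a + b ≤ N → + (2 + a + b) ℤ.* β (suc a) b ≡ + suc a ℤ.* β a b
    β-sucʳ : ∀ a b → 2 + a + b ≤ N → + (2 + a + b) ℤ.* β a (suc b) ≡ + suc b ℤ.* β a b

    β-sucˡ a zero 2+a≤N = begin
      + (2 + a + 0) ℤ.* + (M / (2 + a))   ≡⟨ cong (λ t → + t ℤ.* + (M / (2 + a))) (+-identityʳ (2 + a)) ⟩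
      + (2 + a) ℤ.* + (M / (2 + a))       ≡⟨ ℤₚ.pos-* (2 + a) (M / (2 + a)) ⟨
      + ((2 + a) * (M / (2 + a)))         ≡⟨ cong +_ (DivMod.m*[n/m]≡n (divisible (2 + a) _ 2+a≤N′)) ⟩
      + M                                 ≡⟨ cong +_ (DivMod.m*[n/m]≡n (divisible (suc a) _ (≤-trans (n≤1+n _) 2+a≤N′))) ⟨
      + (suc a * (M / suc a))             ≡⟨ ℤₚ.pos-* (suc a) (M / suc a) ⟩
      + suc a ℤ.* + (M / suc a)           ∎
      where
      open ≡-Reasoning
      2+a≤N′ : 2 + a ≤ N
      2+a≤N′ = subst (_≤ N) (+-identityʳ (2 + a)) 2+a≤N
    β-sucˡ a (suc b) 3+a+b≤N = begin
      + (2 + a + suc b) ℤ.* (β (suc a) b ℤ.- β (2 + a) b)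
        ≡⟨ cong (λ t → + t ℤ.* (β (suc a) b ℤ.- β (2 + a) b)) (+-suc (2 + a) b) ⟩
      + (3 + a + b) ℤ.* (β (suc a) b ℤ.- β (2 + a) b)
        ≡⟨ ring₁ (+ (3 + a + b)) (β (suc a) b) (β (2 + a) b) ⟩
      + (3 + a + b) ℤ.* β (suc a) b ℤ.- + (3 + a + b) ℤ.* β (2 + a) b
        ≡⟨ cong (ℤ._-_ (+ (3 + a + b) ℤ.* β (suc a) b)) (β-sucˡ (suc a) b 3+a+b≤N′) ⟩
      + (3 + a + b) ℤ.* β (suc a) b ℤ.- + (2 + a) ℤ.* β (suc a) b
        ≡⟨ ring₂ (+ a) (+ b) (β (suc a) b) ⟩
      (+ (2 + a + b) ℤ.- + suc a) ℤ.* β (suc a) b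
        ≡⟨ ring₃ (+ (2 + a + b)) (+ suc a) (β (suc a) b) ⟩
      + (2 + a + b) ℤ.* β (suc a) b ℤ.- + suc a ℤ.* β (suc a) b
        ≡⟨ cong (ℤ._- + suc a ℤ.* β (suc a) b) (β-sucˡ a b (≤-trans (n≤1+n _) 3+a+b≤N′)) ⟩
      + suc a ℤ.* β a b ℤ.- + suc a ℤ.* β (suc a) b
        ≡⟨ ring₁ (+ suc a) (β a b) (β (suc a) b) ⟨
      + suc a ℤ.* (β a b ℤ.- β (suc a) b) ∎
      where
      open ≡-Reasoning
      3+a+b≤N′ : 3 + a + b ≤ N
      3+a+b≤N′ = subst (_≤ N) (+-suc (2 + a) b) 3+a+b≤N
      ring₁ : ∀ c x y → c ℤ.* (x ℤ.- y) ≡ c ℤ.* x ℤ.- c ℤ.* y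
      ring₁ = ℤRing.solve-∀
      ring₂ : ∀ a b x → (+ 3 ℤ.+ a ℤ.+ b) ℤ.* x ℤ.- (+ 2 ℤ.+ a) ℤ.* x
                      ≡ ((+ 2 ℤ.+ a ℤ.+ b) ℤ.- (+ 1 ℤ.+ a)) ℤ.* x
      ring₂ = ℤRing.solve-∀
      ring₃ : ∀ c d x → (c ℤ.- d) ℤ.* x ≡ c ℤ.* x ℤ.- d ℤ.* x
      ring₃ = ℤRing.solve-∀

    β-sucʳ a b 2+a+b≤N = begin
      + (2 + a + b) ℤ.* (β a b ℤ.- β (suc a) b)
        ≡⟨ ring₁ (+ (2 + a + b)) (β a b) (β (suc a) b) ⟩
      + (2 + a + b) ℤ.* β a b ℤ.- + (2 + a + b) ℤ.* β (suc a) b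
        ≡⟨ cong (ℤ._-_ (+ (2 + a + b) ℤ.* β a b)) (β-sucˡ a b 2+a+b≤N) ⟩
      + (2 + a + b) ℤ.* β a b ℤ.- + suc a ℤ.* β a b
        ≡⟨ ring₂ (+ a) (+ b) (β a b) ⟩
      + suc b ℤ.* β a b ∎
      where
      open ≡-Reasoning
      ring₁ : ∀ c x y → c ℤ.* (x ℤ.- y) ≡ c ℤ.* x ℤ.- c ℤ.* y
      ring₁ = ℤRing.solve-∀
      ring₂ : ∀ a b x → (+ 2 ℤ.+ a ℤ.+ b) ℤ.* x ℤ.- (+ 1 ℤ.+ a) ℤ.* x ≡ (+ 1 ℤ.+ b) ℤ.* x
      ring₂ = ℤRing.solve-∀

    -- The definition by differences hides the sign; `β-sucʳ` carries positivity over from `b` to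
    -- `suc b`.
    β-positive : NonZero M → ∀ a b → suc (a + b) ≤ N → + 0 ℤ.< β a b
    β-positive M≢0 a zero    1+a≤N = ℤ.+<+ (DivMod.m≥n⇒m/n>0 (∣⇒≤ {{M≢0}} (divisible (suc a) _ (subst (λ t → suc t ≤ N) (+-identityʳ a) 1+a≤N))))
    β-positive M≢0 a (suc b) 2+a+b≤N = ℤₚ.*-cancelˡ-<-nonNeg (+ (2 + a + b))
      (subst₂ ℤ._<_ (trans (ℤₚ.*-zeroʳ (+ suc b)) (sym (ℤₚ.*-zeroʳ (+ (2 + a + b))))) (sym (β-sucʳ a b 2+a+b≤N′))
        (ℤₚ.*-monoˡ-<-pos (+ suc b) (β-positive M≢0 a b (≤-trans (n≤1+n _) 2+a+b≤N′))))
      where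
      2+a+b≤N′ : 2 + a + b ≤ N
      2+a+b≤N′ = subst (λ t → suc t ≤ N) (+-suc a b) 2+a+b≤N

    -- This replaces the pointwise estimate `x (1 - x) ≤ 1/4`: the exact ratio of the two central
    -- values is `(m + 1) / (4m + 6)`.
    β-central-step : NonZero M → ∀ m → 3 + (m + m) ≤ N → + 4 ℤ.* β (suc m) (suc m) ℤ.≤ β m m
    β-central-step M≢0 m 3+2m≤N = ℤₚ.*-cancelˡ-≤-pos _ _ (+ suc m) (begin
      + suc m ℤ.* (+ 4 ℤ.* β (suc m) (suc m))
        -- The added `2 β` completes `4 (m + 1)` to `2 (2m + 3)`, the factor to which `β-sucʳ`
        -- applies.
        ≤⟨ ℤₚ.i≤i+j _ (+ 2 ℤ.* β (suc m) (suc m)) {{ℤ.nonNegative (ℤₚ.*-monoˡ-≤-nonNeg (+ 2) (ℤₚ.<⇒≤ β>0))}} ⟩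
      + suc m ℤ.* (+ 4 ℤ.* β (suc m) (suc m)) ℤ.+ + 2 ℤ.* β (suc m) (suc m)
        ≡⟨ ring₁ (+ m) (β (suc m) (suc m)) ⟩
      + 2 ℤ.* (+ (3 + (m + m)) ℤ.* β (suc m) (suc m))
        ≡⟨ cong (+ 2 ℤ.*_) (β-sucʳ (suc m) m 3+2m≤N) ⟩
      + 2 ℤ.* (+ suc m ℤ.* β (suc m) m)
        ≡⟨ ring₂ (+ m) (β (suc m) m) ⟩
      + (2 + (m + m)) ℤ.* β (suc m) m
        ≡⟨ β-sucˡ m m (≤-trans (n≤1+n _) 3+2m≤N) ⟩
      + suc m ℤ.* β m m ∎)
      where
      open ℤₚ.≤-Reasoning
      β>0 : + 0 ℤ.< β (suc m) (suc m)
      β>0 = β-positive M≢0 (suc m) (suc m) (subst (λ t → 2 + t ≤ N) (sym (+-suc m m)) 3+2m≤N)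
      ring₁ : ∀ m x → (+ 1 ℤ.+ m) ℤ.* (+ 4 ℤ.* x) ℤ.+ + 2 ℤ.* x ≡ + 2 ℤ.* ((+ 3 ℤ.+ (m ℤ.+ m)) ℤ.* x)
      ring₁ = ℤRing.solve-∀
      ring₂ : ∀ m x → + 2 ℤ.* ((+ 1 ℤ.+ m) ℤ.* x) ≡ (+ 2 ℤ.+ (m ℤ.+ m)) ℤ.* x
      ring₂ = ℤRing.solve-∀

    4^m*β≤M : NonZero M → ∀ m → suc (m + m) ≤ N → + (4 ^ m) ℤ.* β m m ℤ.≤ + M
    4^m*β≤M M≢0 zero    1≤N = ℤₚ.≤-reflexive (trans (ℤₚ.*-identityˡ _) (cong +_ (DivMod.n/1≡n M)))
    4^m*β≤M M≢0 (suc m) bound = begin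
      + (4 * 4 ^ m) ℤ.* β (suc m) (suc m)       ≡⟨ cong (ℤ._* β (suc m) (suc m)) (trans (cong +_ (*-comm 4 (4 ^ m))) (ℤₚ.pos-* (4 ^ m) 4)) ⟩
      + (4 ^ m) ℤ.* + 4 ℤ.* β (suc m) (suc m)   ≡⟨ ℤₚ.*-assoc (+ (4 ^ m)) (+ 4) (β (suc m) (suc m)) ⟩
      + (4 ^ m) ℤ.* (+ 4 ℤ.* β (suc m) (suc m)) ≤⟨ ℤₚ.*-monoˡ-≤-nonNeg (+ (4 ^ m)) (β-central-step M≢0 m bound′) ⟩
      + (4 ^ m) ℤ.* β m m                       ≤⟨ 4^m*β≤M M≢0 m (≤-trans (n≤1+n _) (≤-trans (n≤1+n _) bound′)) ⟩
      + M                                       ∎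
      where
      open ℤₚ.≤-Reasoning
      bound′ : 3 + (m + m) ≤ N
      bound′ = subst (λ t → 2 + t ≤ N) (+-suc m m) bound

    4^m≤M : NonZero M → ∀ m → suc (m + m) ≤ N → 4 ^ m ≤ M
    4^m≤M M≢0 m bound = ℤₚ.drop‿+≤+ (begin
      + (4 ^ m)              ≡⟨ ℤₚ.*-identityʳ (+ (4 ^ m)) ⟨
      + (4 ^ m) ℤ.* + 1      ≤⟨ ℤₚ.*-monoˡ-≤-nonNeg (+ (4 ^ m)) (ℤₚ.i<j⇒suc[i]≤j (β-positive M≢0 m m bound)) ⟩
      + (4 ^ m) ℤ.* β m m    ≤⟨ 4^m*β≤M M≢0 m bound ⟩
      + M                    ∎)
      where open ℤₚ.≤-Reasoning

  topPower>0 : ∀ p .{{_ : NonZero p}} N k → 0 < topPower p N k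
  topPower>0 p N zero    = z<s
  topPower>0 p N (suc k) with p ^ suc k ≤? N
  ... | yes _ = m^n>0 p (suc k)
  ... | no  _ = topPower>0 p N k

  commonMultiple>0 : ∀ N {ps} → All Prime ps → 0 < commonMultiple N ps
  commonMultiple>0 N []               = z<s
  commonMultiple>0 N (_∷_ {p} pp pps) = *-mono-≤ (topPower>0 p {{prime⇒nonZero pp}} N N) (commonMultiple>0 N pps)

  chebyshev : ∀ m ps → All Prime ps → (∀ {p} → Prime p → p ≤ suc (m + m) → p ∈ ps) →
              4 ^ m ≤ suc (m + m) ^ length ps
  chebyshev m ps prime complete = ≤-trans
    (Beta.4^m≤M (commonMultiple N ps) N (∣commonMultiple complete) (>-nonZero (commonMultiple>0 N prime)) m ≤-refl)
    (commonMultiple≤ (s≤s z≤n) ps)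
    where
    N : ℕ
    N = suc (m + m)

-- Counting the small primes: the rank bound and its growth.

module IsolationsOfI where

  open QuadraticForms
  open Chebyshev
  open import Data.Nat
  open import Data.Nat.Properties
  open import Data.Nat.Primality using (Prime; prime?; prime[2]; prime⇒nonTrivial)
  import Data.Nat.DivMod as DivMod
  import Data.Nat.Tactic.RingSolver as ℕRing
  import Data.Integer as ℤ
  import Data.Integer.Properties as ℤₚ
  import Data.Integer.Tactic.RingSolver as ℤRing
  open import Data.List using (List; []; _∷_; length; filter; upTo; applyUpTo)
  import Data.List.Properties as Listₚ
  open import Data.List.Relation.Unary.All as All using (All)
  import Data.List.Relation.Unary.All.Properties as Allₚ
  open import Data.List.Relation.Unary.AllPairs using (AllPairs)
  open import Data.List.Relation.Unary.Any using (here)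
  import Data.List.Relation.Unary.Unique.Propositional.Properties as Uniqueₚ
  open import Data.List.Membership.Propositional using (_∈_)
  open import Data.List.Membership.Propositional.Properties using (∈-filter⁺; ∈-filter⁻; ∈-upTo⁺)
  open import Data.Product using (∃; _×_; _,_; proj₁)
  open import Relation.Nullary using (Dec; yes; no)
  open import Relation.Nullary.Decidable using (_×-dec_)
  open import Relation.Binary.PropositionalEquality

  small? : ∀ n p → Dec (Prime p × 2 * p * p < n)
  small? n p = prime? p ×-dec (2 * p * p <? n)

  -- Definitionally the list whose length is `primesBelowSqrtHalf n`.
  smallPrimes : ℕ → List ℕ
  smallPrimes n = filter (small? n) (upTo n)

  8<n⇒smallPrimes : ∀ n → 8 < n → ∃ λ ps → smallPrimes n ≡ 2 ∷ ps
  8<n⇒smallPrimes (suc zero)          (s≤s ())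
  8<n⇒smallPrimes (suc (suc zero))    (s≤s (s≤s ()))
  8<n⇒smallPrimes (suc (suc (suc n))) 8<n =
    filter (small? (3 + n)) rest , Listₚ.filter-accept (small? (3 + n)) {2} {rest} (prime[2] , 8<n)
    where
    rest : List ℕ
    rest = applyUpTo (3 +_) n

  smallPrimes-nonempty⇒8<n : ∀ {n p} → p ∈ smallPrimes n → 8 < n
  smallPrimes-nonempty⇒8<n {n} {p} p∈ =
    let _ , pp , 2pp<n = ∈-filter⁻ (small? n) {xs = upTo n} p∈
        2≤p = nonTrivial⇒n>1 p {{prime⇒nonTrivial pp}}
    in ≤-<-trans (*-mono-≤ (*-monoʳ-≤ 2 2≤p) 2≤p) 2pp<n

  -- If any prime is small then so is 2, as `8 ≤ 2p² < n`; and 2 comes first since the list is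
  -- increasing. This splits off the summand `D`.
  smallPrimes-split : ∀ n → 1 ≤ length (smallPrimes n) → ∃ λ ps → smallPrimes n ≡ 2 ∷ ps
  smallPrimes-split n 1≤t with smallPrimes n in eq
  ... | p ∷ ps = subst (λ xs → ∃ λ ps → xs ≡ 2 ∷ ps) eq
        (8<n⇒smallPrimes n (smallPrimes-nonempty⇒8<n {n} {p} (subst (p ∈_) (sym eq) (here refl))))

  -- The number `t` is a variable with an equation so that `rank-bound` can use the result after
  -- matching on the length.
  represents-sum-of-copies : ∀ {m L} → IsIsolation (I (suc m)) L → ∀ {t} → 1 ≤ t → t ≡ length (smallPrimes (suc m)) →
                   Represents L (I m ⊥ D (suc m) ⊥ copies (t ∸ 1) (Aminus1 (suc m)))
  represents-sum-of-copies {m} {L} iso 1≤t refl =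
    let ps , eq = smallPrimes-split (suc m) 1≤t
        distinct = subst (AllPairs _≢_) eq (Uniqueₚ.filter⁺ (small? (suc m)) (Uniqueₚ.upTo⁺ (suc m)))
        small    = subst (All (λ p → Prime p × 2 * p * p < suc m)) eq (Allₚ.all-filter (small? (suc m)) (upTo (suc m)))
    in subst (λ t → Represents L (I m ⊥ D (suc m) ⊥ copies (t ∸ 1) (Aminus1 (suc m)))) (sym (cong length eq))
         (Isolation.represents-sum iso (All.head small) distinct (All.tail small))

  -- This is `2n - 1 + (n - 1)(t - 1)` in the subtraction-free form `n + (n - 1) t`, which also
  -- covers `t = 0`.
  rank-bound : ∀ {m L} → IsIsolation (I (suc m)) L → suc m + m * length (smallPrimes (suc m)) ≤ rank L
  rank-bound {m} {L} iso with length (smallPrimes (suc m)) in eq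
  ... | zero  = subst (_≤ rank L) (sym (trans (cong (suc m +_) (*-zeroʳ m)) (+-identityʳ (suc m)))) (Isolation.rank≥n iso)
  ... | suc t = subst (_≤ rank L) ranks
    (represents⇒rank≤ {L} {M} (Definite.anisotropic definite) (represents-sum-of-copies iso (s≤s z≤n) (sym eq)))
    where
    M : QForm
    M = I m ⊥ D (suc m) ⊥ copies t (Aminus1 (suc m))
    definite : Definite M
    definite = definite-⊥ _ _ (definite-I m) (definite-⊥ _ _ (definite-D (suc m)) (definite-copies t (definite-Aminus1 (suc m))))
    ring : ∀ m t → m + (suc m + t * m) ≡ suc m + m * suc t
    ring = ℕRing.solve-∀
    ranks : rank M ≡ suc m + m * suc t
    ranks = trans (cong (λ x → m + (suc m + x)) (rank-copies t (Aminus1 (suc m)))) (ring m t)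

  -- The cutoff is odd because `chebyshev` works at `2m + 1`. The lower bound makes every prime up
  -- to `2m + 1` small; the upper bound keeps `2m + 1` within 2 of √(n/2).
  odd-bracket : ∀ n → 3 ≤ n → ∃ λ m → 2 * suc (m + m) * suc (m + m) < n × n ≤ 2 * (3 + (m + m)) * (3 + (m + m))
  odd-bracket (suc zero)             (s≤s ())
  odd-bracket (suc (suc zero))       (s≤s (s≤s ()))
  odd-bracket (suc (suc (suc zero))) _ = 0 , ≤-refl , s≤s (s≤s (s≤s z≤n))
  odd-bracket (suc (suc (suc (suc n)))) _ with odd-bracket (suc (suc (suc n))) (s≤s (s≤s (s≤s z≤n)))
  ... | m , lower , upper with 4 + n ≤? 2 * (3 + (m + m)) * (3 + (m + m))
  ... | yes upper′ = m , m<n⇒m<1+n lower , upper′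
  ... | no  ¬upper = suc m , subst (λ k → 2 * k * k < 4 + n) (ring m) (≰⇒> ¬upper) , (begin
    4 + n                                           ≤⟨ s≤s upper ⟩
    -- The slack is `2(2m + 5)² - 2(2m + 3)² - 1 = 31 + 16m`.
    suc (2 * (3 + (m + m)) * (3 + (m + m)))         ≤⟨ m≤m+n _ (31 + 16 * m) ⟩
    suc (2 * (3 + (m + m)) * (3 + (m + m))) + (31 + 16 * m)  ≡⟨ ring₂ m ⟩
    2 * (3 + (suc m + suc m)) * (3 + (suc m + suc m))  ∎)
    where
    open ≤-Reasoning
    ring : ∀ m → 3 + (m + m) ≡ suc (suc m + suc m)
    ring = ℕRing.solve-∀
    ring₂ : ∀ m → suc (2 * (3 + (m + m)) * (3 + (m + m))) + (31 + 16 * m) ≡ 2 * (3 + (suc m + suc m)) * (3 + (suc m + suc m))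
    ring₂ = ℕRing.solve-∀

  binary-bracket : ∀ n → 1 ≤ n → ∃ λ ℓ → n ≤ 2 ^ ℓ × 2 ^ ℓ ≤ 2 * n
  binary-bracket (suc zero) _ = 0 , ≤-refl , s≤s z≤n
  binary-bracket (suc (suc n)) _ with binary-bracket (suc n) (s≤s z≤n)
  ... | ℓ , upper , lower with 2 + n ≤? 2 ^ ℓ
  ... | yes upper′ = ℓ , upper′ , ≤-trans lower (*-monoʳ-≤ 2 (n≤1+n (suc n)))
  ... | no  ¬upper = suc ℓ , subst (2 + n ≤_) (cong (2 ^ ℓ +_) (sym (+-identityʳ (2 ^ ℓ)))) (+-mono-≤ (m^n>0 2 ℓ) upper)
                           , *-monoʳ-≤ 2 (<⇒≤ (≰⇒> ¬upper))

  ^-distribʳ-* : ∀ k m n → (m * n) ^ k ≡ m ^ k * n ^ k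
  ^-distribʳ-* zero    m n = refl
  ^-distribʳ-* (suc k) m n = trans (cong (m * n *_) (^-distribʳ-* k m n)) (ring m n (m ^ k) (n ^ k))
    where
    ring : ∀ m n x y → m * n * (x * y) ≡ m * x * (n * y)
    ring = ℕRing.solve-∀

  -- Write ℓ = r + q j with r < j, so that ℓ ≤ j (q + 1) ≤ j 2^q.
  power≤exponential : ∀ j .{{_ : NonZero j}} ℓ → ℓ ^ j ≤ j ^ j * 2 ^ ℓ
  power≤exponential j ℓ = begin
    ℓ ^ j                     ≤⟨ ^-monoˡ-≤ j ℓ≤ ⟩
    (j * 2 ^ q) ^ j           ≡⟨ ^-distribʳ-* j j (2 ^ q) ⟩
    j ^ j * (2 ^ q) ^ j       ≡⟨ cong (j ^ j *_) (^-*-assoc 2 q j) ⟩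
    j ^ j * 2 ^ (q * j)       ≤⟨ *-monoʳ-≤ (j ^ j) (^-monoʳ-≤ 2 (DivMod.m/n*n≤m ℓ j)) ⟩
    j ^ j * 2 ^ ℓ             ∎
    where
    open ≤-Reasoning
    q : ℕ
    q = ℓ / j
    ℓ≤ : ℓ ≤ j * 2 ^ q
    ℓ≤ = begin
      ℓ                   ≡⟨ DivMod.m≡m%n+[m/n]*n ℓ j ⟩
      ℓ % j + q * j       ≤⟨ +-monoˡ-≤ (q * j) (<⇒≤ (DivMod.m%n<n ℓ j)) ⟩
      suc q * j           ≤⟨ *-monoˡ-≤ j (n<p^n (s≤s (s≤s z≤n)) q) ⟩
      2 ^ q * j           ≡⟨ *-comm (2 ^ q) j ⟩
      j * 2 ^ q           ∎

  ^-cancel-≤ : ∀ {b} → 1 < b → ∀ {m n} → b ^ m ≤ b ^ n → m ≤ n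
  ^-cancel-≤ 1<b bᵐ≤bⁿ = ≮⇒≥ λ n<m → <⇒≱ (^-monoʳ-< _ 1<b n<m) bᵐ≤bⁿ

  -- n ≤ 2 (2m + 3)² and 2m ≤ ℓ t, where 2^ℓ is about 2m + 1 ≤ n.
  smallPrimes-growth : ∀ k .{{_ : NonZero k}} n → 3 ≤ n →
    n ^ k ≤ 18 ^ k * (4 * (2 * k) ^ (2 * k)) * n * suc (length (smallPrimes n)) ^ (2 * k)
  smallPrimes-growth k n 3≤n with odd-bracket n 3≤n
  ... | m , lower , upper with binary-bracket (suc (m + m)) (s≤s z≤n)
  ... | ℓ , N≤2^ℓ , 2^ℓ≤2N = begin
    n ^ k                                         ≤⟨ ^-monoˡ-≤ k n≤ ⟩
    (18 * (suc ℓ * suc t) ^ 2) ^ k                ≡⟨ ^-distribʳ-* k 18 ((suc ℓ * suc t) ^ 2) ⟩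
    18 ^ k * ((suc ℓ * suc t) ^ 2) ^ k            ≡⟨ cong (18 ^ k *_) (^-*-assoc (suc ℓ * suc t) 2 k) ⟩
    18 ^ k * (suc ℓ * suc t) ^ j                  ≡⟨ cong (18 ^ k *_) (^-distribʳ-* j (suc ℓ) (suc t)) ⟩
    18 ^ k * (suc ℓ ^ j * suc t ^ j)              ≤⟨ *-monoʳ-≤ (18 ^ k) (*-monoˡ-≤ (suc t ^ j) ℓ^j≤) ⟩
    18 ^ k * (4 * j ^ j * n * suc t ^ j)          ≡⟨ ring (18 ^ k) (4 * j ^ j) n (suc t ^ j) ⟩
    18 ^ k * (4 * j ^ j) * n * suc t ^ j          ∎
    where
    open ≤-Reasoning
    t j N : ℕ
    t = length (smallPrimes n)
    j = 2 * k
    N = suc (m + m)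
    instance
      j≢0 : NonZero j
      j≢0 = m*n≢0 2 k
    ring : ∀ a b c d → a * (b * c * d) ≡ a * b * c * d
    ring = ℕRing.solve-∀
    N<n : N < n
    N<n = ≤-<-trans (m≤m*n N N) (≤-<-trans (*-monoˡ-≤ N (m≤n*m N 2)) lower)
    complete : ∀ {p} → Prime p → p ≤ N → p ∈ smallPrimes n
    complete {p} pp p≤N = ∈-filter⁺ (small? n) (∈-upTo⁺ (≤-<-trans p≤N N<n))
      (pp , ≤-<-trans (*-mono-≤ (*-monoʳ-≤ 2 p≤N) p≤N) lower)
    2m≤ℓt : 2 * m ≤ ℓ * t
    2m≤ℓt = ^-cancel-≤ (s≤s (s≤s z≤n)) (begin
      2 ^ (2 * m)       ≡⟨ ^-*-assoc 2 2 m ⟨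
      4 ^ m             ≤⟨ chebyshev m (smallPrimes n) (All.map proj₁ (Allₚ.all-filter (small? n) (upTo n))) complete ⟩
      N ^ t             ≤⟨ ^-monoˡ-≤ t N≤2^ℓ ⟩
      (2 ^ ℓ) ^ t       ≡⟨ ^-*-assoc 2 ℓ t ⟩
      2 ^ (ℓ * t)       ∎)
    -- Passing to `suc ℓ` and `suc t` absorbs the summand 3 into a product, even when `ℓ` or `t` is
    -- zero.
    2m+3≤ : 3 + (m + m) ≤ 3 * (suc ℓ * suc t)
    2m+3≤ = begin
      3 + (m + m)                       ≡⟨ cong (λ x → 3 + (m + x)) (+-identityʳ m) ⟨
      3 + 2 * m                         ≤⟨ +-monoʳ-≤ 3 2m≤ℓt ⟩
      3 + ℓ * t                         ≤⟨ m≤m+n _ (2 * (ℓ * t) + 3 * ℓ + 3 * t) ⟩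
      3 + ℓ * t + (2 * (ℓ * t) + 3 * ℓ + 3 * t) ≡⟨ ring₂ ℓ t ⟩
      3 * (suc ℓ * suc t)               ∎
      where
      ring₂ : ∀ ℓ t → 3 + ℓ * t + (2 * (ℓ * t) + 3 * ℓ + 3 * t) ≡ 3 * (suc ℓ * suc t)
      ring₂ = ℕRing.solve-∀
    n≤ : n ≤ 18 * (suc ℓ * suc t) ^ 2
    n≤ = begin
      n                                                     ≤⟨ upper ⟩
      2 * (3 + (m + m)) * (3 + (m + m))                     ≤⟨ *-mono-≤ (*-monoʳ-≤ 2 2m+3≤) 2m+3≤ ⟩
      2 * (3 * (suc ℓ * suc t)) * (3 * (suc ℓ * suc t))     ≡⟨ ring₃ (suc ℓ * suc t) ⟩
      18 * (suc ℓ * suc t) ^ 2                              ∎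
      where
      ring₃ : ∀ x → 2 * (3 * x) * (3 * x) ≡ 18 * (x * (x * 1))
      ring₃ = ℕRing.solve-∀
    -- The logarithmic loss `ℓ`, raised to the power `2k`, costs a constant and a single factor `n`.
    ℓ^j≤ : suc ℓ ^ j ≤ 4 * j ^ j * n
    ℓ^j≤ = begin
      suc ℓ ^ j                   ≤⟨ power≤exponential j (suc ℓ) ⟩
      j ^ j * (2 * 2 ^ ℓ)         ≤⟨ *-monoʳ-≤ (j ^ j) (*-monoʳ-≤ 2 2^ℓ≤2N) ⟩
      j ^ j * (2 * (2 * N))       ≤⟨ *-monoʳ-≤ (j ^ j) (*-monoʳ-≤ 2 (*-monoʳ-≤ 2 (<⇒≤ N<n))) ⟩
      j ^ j * (2 * (2 * n))       ≡⟨ ring₄ (j ^ j) n ⟩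
      4 * j ^ j * n               ∎
      where
      ring₄ : ∀ a n → a * (2 * (2 * n)) ≡ 4 * a * n
      ring₄ = ℕRing.solve-∀

  -- Twice the constant of `smallPrimes-growth`; the 2 comes from `n (t + 1) ≤ 2R`.
  growthConstant : ℕ → ℕ
  growthConstant k = 2 * (18 ^ k * (4 * (2 * k) ^ (2 * k)))

  growthConstant>0 : ∀ k .{{_ : NonZero k}} → 1 ≤ growthConstant k
  growthConstant>0 k = *-mono-≤ {1} {2} (s≤s z≤n)
    (*-mono-≤ (m^n>0 18 k) (*-mono-≤ {1} {4} (s≤s z≤n) (m^n>0 (2 * k) {{m*n≢0 2 k}} (2 * k))))

  -- With `d` the constant, this says `R ≥ n^(3/2 - 1/k) / d`, cleared of roots and denominators.
  rank-growth : ∀ k .{{_ : NonZero k}} n → 3 ≤ n → ∀ {R} → n + (n ∸ 1) * length (smallPrimes n) ≤ R →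
    n ^ (3 * k ∸ 2) ≤ growthConstant k ^ (2 * k) * R ^ (2 * k)
  -- Multiplication by `n²` turns the exponent into `3k = k + 2k`: the part `k` feeds
  -- `smallPrimes-growth`, the part `2k` joins the power of `t + 1`.
  rank-growth k n@(suc n′) 3≤n {R} bound = *-cancelʳ-≤ _ _ (n * n) (begin
    n ^ (3 * k ∸ 2) * (n * n)           ≡⟨ cong (λ x → n ^ (3 * k ∸ 2) * (n * x)) (*-identityʳ n) ⟨
    n ^ (3 * k ∸ 2) * n ^ 2             ≡⟨ ^-distribˡ-+-* n (3 * k ∸ 2) 2 ⟨
    n ^ (3 * k ∸ 2 + 2)                 ≡⟨ cong (n ^_) (m∸n+n≡m 2≤3k) ⟩
    n ^ (3 * k)                         ≡⟨ ^-distribˡ-+-* n k (2 * k) ⟩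
    n ^ k * n ^ j                       ≤⟨ *-monoˡ-≤ (n ^ j) (smallPrimes-growth k n 3≤n) ⟩
    C * n * suc t ^ j * n ^ j           ≡⟨ ring C n (suc t ^ j) (n ^ j) ⟩
    C * n * (n ^ j * suc t ^ j)         ≡⟨ cong (C * n *_) (^-distribʳ-* j n (suc t)) ⟨
    C * n * (n * suc t) ^ j             ≤⟨ *-monoʳ-≤ (C * n) (^-monoˡ-≤ j n[1+t]≤2R) ⟩
    C * n * (2 * R) ^ j                 ≡⟨ cong (C * n *_) (^-distribʳ-* j 2 R) ⟩
    -- A factor `n` is given away to reach the exponent `3k - 2`, and `C ≤ C^j` brings the constant
    -- under the power `2k`.
    C * n * (2 ^ j * R ^ j)             ≤⟨ *-monoˡ-≤ (2 ^ j * R ^ j) (*-mono-≤ C≤C^j (m≤m*n n n)) ⟩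
    C ^ j * (n * n) * (2 ^ j * R ^ j)   ≡⟨ ring₂ (C ^ j) (n * n) (2 ^ j) (R ^ j) ⟩
    2 ^ j * C ^ j * R ^ j * (n * n)     ≡⟨ cong (λ x → x * R ^ j * (n * n)) (^-distribʳ-* j 2 C) ⟨
    (2 * C) ^ j * R ^ j * (n * n)       ∎)
    where
    open ≤-Reasoning
    t j C : ℕ
    t = length (smallPrimes n)
    j = 2 * k
    C = 18 ^ k * (4 * j ^ j)
    instance
      j≢0 : NonZero j
      j≢0 = m*n≢0 2 k
      C≢0 : NonZero C
      C≢0 = m*n≢0 (18 ^ k) (4 * j ^ j) {{m^n≢0 18 k}} {{m*n≢0 4 (j ^ j) {{_}} {{m^n≢0 j j}}}}
    2≤3k : 2 ≤ 3 * k
    2≤3k = ≤-trans (s≤s (s≤s z≤n)) (*-monoʳ-≤ 3 (>-nonZero⁻¹ k))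
    C≤C^j : C ≤ C ^ j
    C≤C^j = subst (_≤ C ^ j) (^-identityʳ C) (^-monoʳ-≤ C (>-nonZero⁻¹ j))
    ring : ∀ c n x y → c * n * x * y ≡ c * n * (y * x)
    ring = ℕRing.solve-∀
    ring₂ : ∀ c n x y → c * n * (x * y) ≡ x * c * y * n
    ring₂ = ℕRing.solve-∀
    n[1+t]≤2R : n * suc t ≤ 2 * R
    n[1+t]≤2R = begin
      n * suc t                      ≡⟨ ring₃ n′ t ⟩
      n + (t + n′ * t)               ≤⟨ +-monoʳ-≤ n (+-monoˡ-≤ (n′ * t) (m≤n*m t n′ {{>-nonZero (≤-trans (s≤s z≤n) (≤-pred 3≤n))}})) ⟩
      n + (n′ * t + n′ * t)          ≤⟨ m≤n+m _ n ⟩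
      n + (n + (n′ * t + n′ * t))    ≡⟨ ring₄ n (n′ * t) ⟩
      2 * (n + n′ * t)               ≤⟨ *-monoʳ-≤ 2 bound ⟩
      2 * R                          ∎
      where
      ring₃ : ∀ n t → suc n * suc t ≡ suc n + (t + n * t)
      ring₃ = ℕRing.solve-∀
      ring₄ : ∀ n x → n + (n + (x + x)) ≡ 2 * (n + x)
      ring₄ = ℕRing.solve-∀

  -- Over the integers `t - 1` is not truncated: for `t = 0` it is -1 and the bound reduces to `n`.
  rank-bound⇒ℤ : ∀ m t R → suc m + m * t ≤ R →
    (ℤ.+ (2 * suc m) ℤ.- ℤ.+ 1) ℤ.+ (ℤ.+ m) ℤ.* (ℤ.+ t ℤ.- ℤ.+ 1) ℤ.≤ ℤ.+ R
  rank-bound⇒ℤ m t R bound = subst (ℤ._≤ ℤ.+ R) (sym (begin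
    (ℤ.+ (2 * suc m) ℤ.- ℤ.+ 1) ℤ.+ (ℤ.+ m) ℤ.* (ℤ.+ t ℤ.- ℤ.+ 1)
      ≡⟨ cong (λ x → (x ℤ.- ℤ.+ 1) ℤ.+ (ℤ.+ m) ℤ.* (ℤ.+ t ℤ.- ℤ.+ 1)) (ℤₚ.pos-* 2 (suc m)) ⟩
    (ℤ.+ 2 ℤ.* ℤ.+ suc m ℤ.- ℤ.+ 1) ℤ.+ (ℤ.+ m) ℤ.* (ℤ.+ t ℤ.- ℤ.+ 1)
      ≡⟨ ring (ℤ.+ m) (ℤ.+ t) ⟩
    ℤ.+ suc m ℤ.+ ℤ.+ m ℤ.* ℤ.+ t
      ≡⟨ cong (ℤ._+_ (ℤ.+ suc m)) (ℤₚ.pos-* m t) ⟨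
    ℤ.+ (suc m + m * t) ∎)) (ℤ.+≤+ bound)
    where
    open ≡-Reasoning
    ring : ∀ m t → (ℤ.+ 2 ℤ.* (ℤ.+ 1 ℤ.+ m) ℤ.- ℤ.+ 1) ℤ.+ m ℤ.* (t ℤ.- ℤ.+ 1) ≡ (ℤ.+ 1 ℤ.+ m) ℤ.+ m ℤ.* t
    ring = ℤRing.solve-∀

open import Data.Nat as ℕ using (ℕ; _≤_; _<_; _^_; _∸_)
open import Data.Integer as ℤ using (+_)
open import Data.Product using (Σ; _×_)

theorem4p7 : ((n : ℕ) → 1 < n →
    ((L : QForm) → IsIsolation (I n) L → 1 ≤ primesBelowSqrtHalf n →
    Represents L (I (n ∸ 1) ⊥ D n ⊥ copies (primesBelowSqrtHalf n ∸ 1) (Aminus1 n)))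
    × ((L : QForm) → IsIsolation (I n) L →
    (+ (2 ℕ.* n) ℤ.- + 1) ℤ.+ (+ (n ∸ 1)) ℤ.* (+ primesBelowSqrtHalf n ℤ.- + 1)
    ℤ.≤ + rank L))
    × ((k : ℕ) → 1 ≤ k →
    Σ ℕ λ d → 1 ≤ d × Σ ℕ λ N → (n : ℕ) → N ≤ n → (L : QForm) → IsIsolation (I n) L →
    n ^ (3 ℕ.* k ∸ 2) ≤ d ^ (2 ℕ.* k) ℕ.* rank L ^ (2 ℕ.* k))
theorem4p7 = (λ { (ℕ.suc m) _ → (λ L iso 1≤t → represents-sum-of-copies iso 1≤t refl)
                              , (λ L iso → rank-bound⇒ℤ m (length (smallPrimes (ℕ.suc m))) (rank L) (rank-bound iso)) })
           , growth
  where
  open IsolationsOfI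
  open import Data.Product using (_,_)
  open import Data.List using (length)
  open import Relation.Binary.PropositionalEquality using (refl)
  growth : (k : ℕ) → 1 ≤ k →
    Σ ℕ λ d → 1 ≤ d × Σ ℕ λ N → (n : ℕ) → N ≤ n → (L : QForm) → IsIsolation (I n) L →
    n ^ (3 ℕ.* k ∸ 2) ≤ d ^ (2 ℕ.* k) ℕ.* rank L ^ (2 ℕ.* k)
  -- The threshold 3 is where `odd-bracket` starts, with `2 · 1² < n`.
  growth k@(ℕ.suc _) _ = growthConstant k , growthConstant>0 k , 3 , λ { (ℕ.suc m) 3≤n L iso →
    rank-growth k (ℕ.suc m) 3≤n (rank-bound iso) }
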